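{- Let $q$ be a power of an odd prime. For any $a \in \mathbb{F}_{q^3}^\star$, the polynomial \[ f_a(X) = X^{q+1} + a^{ -1}(X^q + X) + \mathrm{N}(a^{ -1})\,(\mathrm{Tr}(a) - 2a) \in \mathbb{F}_{q^3}[X] \] splits completely in $\mathbb{F}_{q^3}^\star$ (i.e., it factors into linear factors over $\mathbb{F}_{q^3}$ and all its roots are nonzero elements of $\mathbb{F}_{q^3}$). Furthermore, if $a \in \mathbb{F}_q^\star$, then $f_a(X)$ has a single root of multiplicity $q+1$, and if $a \in \mathbb{F}_{q^3} \setminus \mathbb{F}_q$, then the roots of $f_a(X)$ are all distinct.
   Context: $\mathbb{F}_{q}$ denotes the finite field with $q$ elements and $\mathbb{F}_q^\star$ its set of nonzero elements; $\mathbb{F}_q$ is regarded as a subfield of $\mathbb{F}_{q^3}$. $\mathrm{N}$ and $\mathrm{Tr}$ are the norm and trace maps from $\mathbb{F}_{q^3}$ to $\mathbb{F}_q$: $\mathrm{N}(x) = x^{1+q+q^2}$ and $\mathrm{Tr}(x) = x + x^q + x^{q^2}$ for $x \in \mathbb{F}_{q^3}$. -}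

module Defs where

open import Level using (Level; _⊔_; suc)
open import Algebra.Bundles using (CommutativeRing; RawRing)
open import Algebra.Apartness.Bundles using (HeytingCommutativeRing; HeytingField)
import Algebra.Definitions.RawSemiring as RawSemiringDefinitions
open import Algebra.Morphism.Structures using (module RingMorphisms)
open import Data.Fin.Base using (Fin)
open import Data.List.Base using (List; []; _∷_; map)
open import Data.Nat.Base as ℕ using (ℕ; zero; _≥_)
open import Data.Nat.Divisibility using () renaming (_∤_ to _∤ℕ_)
open import Data.Nat.Primality using (Prime)
open import Data.Product.Base using (∃; ∃-syntax; _×_; proj₁)
open import Data.Vec.Functional using (Vector)
open import Function.Bundles using (Bijection)
open import Function.Definitions using (Injective)
open import Relation.Binary.PropositionalEquality using (_≡_) renaming (setoid to ≡-setoid)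

IsOddPrimePower : ℕ → Set
IsOddPrimePower q = ∃[ p ] ∃[ n ] (Prime p × 2 ∤ℕ p × n ≥ 1 × q ≡ p ℕ.^ n)

-- "Nonzero" is `_# 0#`.  A finite field has decidable equality, so this is
-- the same as `_≉ 0#` there.

record FiniteField (c ℓ₁ ℓ₂ : Level) (n : ℕ) : Set (suc (c ⊔ ℓ₁ ⊔ ℓ₂)) where
  field
    heytingField : HeytingField c ℓ₁ ℓ₂

  open HeytingField heytingField public

  commutativeRing : CommutativeRing c ℓ₁
  commutativeRing = HeytingCommutativeRing.commutativeRing heytingCommutativeRing

  open CommutativeRing commutativeRing public using (rawRing)

  field
    enumeration : Bijection (≡-setoid (Fin n)) setoid

record Embedding {c ℓ₁ ℓ₂ d m₁ m₂ : Level} {m n : ℕ}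
                 (F : FiniteField c ℓ₁ ℓ₂ m) (K : FiniteField d m₁ m₂ n)
                 : Set (c ⊔ ℓ₁ ⊔ d ⊔ m₁) where
  private
    module F = FiniteField F
    module K = FiniteField K
  field
    ⟦_⟧                : F.Carrier → K.Carrier
    isRingMonomorphism : RingMorphisms.IsRingMonomorphism F.rawRing K.rawRing ⟦_⟧

  infix 4 _∈Image

  _∈Image : K.Carrier → Set (c ⊔ m₁)
  y ∈Image = ∃[ x ] ⟦ x ⟧ K.≈ y

-- A polynomial is the list of its coefficients, constant term first.
-- Trailing zeros are allowed; `_≈ₚ_` disregards them.

module Polynomial {c ℓ : Level} (R : RawRing c ℓ) where

  open RawRing R

  infix  8 -ₚ_
  infixl 7 _*ₚ_
  infixl 6 _+ₚ_
  infix  4 _≈ₚ_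

  Poly : Set c
  Poly = List Carrier

  coeff : Poly → ℕ → Carrier
  coeff []      _          = 0#
  coeff (a ∷ f) zero       = a
  coeff (a ∷ f) (ℕ.suc i)  = coeff f i

  record _≈ₚ_ (f g : Poly) : Set ℓ where
    constructor coeffwise
    field
      coeff-≈ : ∀ i → coeff f i ≈ coeff g i

  _+ₚ_ : Poly → Poly → Poly
  []      +ₚ g       = g
  (a ∷ f) +ₚ []      = a ∷ f
  (a ∷ f) +ₚ (b ∷ g) = (a + b) ∷ (f +ₚ g)

  -ₚ_ : Poly → Poly
  -ₚ_ = map (-_)

  -- (a + X f) g = a g + X (f g)
  _*ₚ_ : Poly → Poly → Poly
  []      *ₚ g = []
  (a ∷ f) *ₚ g = map (a *_) g +ₚ (0# ∷ (f *ₚ g))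

  C : Carrier → Poly
  C a = a ∷ []

  X : Poly
  X = 0# ∷ 1# ∷ []

  polyRawRing : RawRing c ℓ
  polyRawRing = record
    { _≈_ = _≈ₚ_ ; _+_ = _+ₚ_ ; _*_ = _*ₚ_ ; -_ = -ₚ_ ; 0# = [] ; 1# = C 1# }

  open RawSemiringDefinitions (RawRing.rawSemiring polyRawRing) public
    using () renaming (_^_ to _^ₚ_; _∣_ to _∣ₚ_; _∤_ to _∤ₚ_; product to ∏ₚ)

  eval : Poly → Carrier → Carrier
  eval []      x = 0#
  eval (a ∷ f) x = a + x * eval f x

  IsRoot : Poly → Carrier → Set ℓ
  IsRoot f x = eval f x ≈ 0#

  X-_ : Carrier → Poly
  X- r = X +ₚ -ₚ C r

  HasMultiplicity : Poly → Carrier → ℕ → Set (c ⊔ ℓ)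
  HasMultiplicity f r m = ((X- r) ^ₚ m ∣ₚ f) × ((X- r) ^ₚ (ℕ.suc m) ∤ₚ f)

  HasSingleRoot : Poly → ℕ → Set (c ⊔ ℓ)
  HasSingleRoot f m =
    ∃[ r ] (IsRoot f r × (∀ s → IsRoot f s → s ≈ r) × HasMultiplicity f r m)

module FieldPolynomial {c ℓ₁ ℓ₂ : Level} {n : ℕ} (K : FiniteField c ℓ₁ ℓ₂ n) where

  open FiniteField K using (Carrier; _≈_; _#_; 0#; rawRing)
  open Polynomial rawRing public

  -- r lists the roots of f with multiplicity.
  IsFactorisation : ∀ {m} → Poly → Vector Carrier m → Set (c ⊔ ℓ₁ ⊔ ℓ₂)
  IsFactorisation f r = ∃[ u ] (u # 0# × f ≈ₚ C u *ₚ ∏ₚ (λ i → X- r i))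

  Splits : Poly → Set (c ⊔ ℓ₁ ⊔ ℓ₂)
  Splits f = ∃[ m ] ∃ λ (r : Vector Carrier m) → IsFactorisation f r

  SplitsIn⋆ : Poly → Set (c ⊔ ℓ₁ ⊔ ℓ₂)
  SplitsIn⋆ f = Splits f × (∀ x → IsRoot f x → x # 0#)

  -- Only meaningful for polynomials that split; otherwise it holds vacuously.
  RootsDistinct : Poly → Set (c ⊔ ℓ₁ ⊔ ℓ₂)
  RootsDistinct f =
    ∀ {m} (r : Vector Carrier m) → IsFactorisation f r → Injective _≡_ _≈_ r

module Fₐ {c ℓ₁ ℓ₂ : Level} (q : ℕ) (K : FiniteField c ℓ₁ ℓ₂ (q ℕ.^ 3)) where

  open FiniteField K
  open RawSemiringDefinitions (RawRing.rawSemiring rawRing)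
    using (_^_) renaming (_×_ to _·_)
  open FieldPolynomial K

  -- Literally the inverse of x - 0#.
  inv : ∀ {x} → x # 0# → Carrier
  inv x#0 = proj₁ (#⇒invertible x#0)

  -- The norm and trace of K over its subfield with q elements, as elements of K.
  N Tr : Carrier → Carrier
  N  x = x ^ (1 ℕ.+ q ℕ.+ q ℕ.^ 2)
  Tr x = x + x ^ q + x ^ (q ℕ.^ 2)

  fₐ : (a : Carrier) → a # 0# → Poly
  fₐ a a#0 = X ^ₚ (q ℕ.+ 1) +ₚ C a⁻¹ *ₚ (X ^ₚ q +ₚ X) +ₚ C (N a⁻¹ * (Tr a - 2 · a))
    where
    a⁻¹ : Carrier
    a⁻¹ = inv a#0

{-# OPTIONS --safe #-}

-- Put b = a⁻¹, φ(x) = x^q and d = b - φ(b), so that d + φ(d) + φ²(d) = 0.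
-- The constant term of f is b φ(b) + b φ²(b) - φ(b) φ²(b), and Y = X + b turns f
-- into Y^(q+1) + d Y + d φ²(d).  If a ∈ F_q, then d = 0 and f = (X + b)^(q+1).
-- Otherwise d and d (x + φ²(b)) / (x + φ(b)), for x ∈ F_q, are q + 1 distinct values
-- of Y at which it vanishes.
--
-- Two monic polynomials of degree n agreeing at n points coincide.  This gives
-- the factorisations of f, and also the additivity of φ, by comparing (X + y)^q with
-- X^q + y^q on F_q, without mentioning the characteristic.

module Submission where

open import Defs
open import Algebra.Bundles using (CommutativeMonoid; CommutativeRing; RawRing)
import Algebra.Definitions.RawMagma as RawMagmaDefinitions
import Algebra.Definitions.RawSemiring as RawSemiringDefinitions
open import Algebra.Morphism.Structures using (module RingMorphisms)
import Algebra.Properties.CommutativeMonoid.Sum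
import Algebra.Properties.CommutativeSemiring.Exp
import Algebra.Properties.Semiring.Exp
import Algebra.Solver.Ring
open import Algebra.Solver.Ring.AlmostCommutativeRing
  using (AlmostCommutativeRing; fromCommutativeRing; _-Raw-AlmostCommutative⟶_)
open import Data.Fin.Base as Fin using (Fin; punchOut)
open import Data.Fin.Permutation using (Permutation; permutation)
import Data.Fin.Properties as Fin
open import Data.Integer.Base as ℤ using (ℤ; +_; -[1+_]; +[1+_]; _⊖_; _◃_)
import Data.Integer.Properties as ℤ
open import Data.List.Base using ([]; _∷_; map)
import Data.Maybe.Base as Maybe
open import Data.Nat.Base as ℕ using (ℕ; zero; suc; z≤n; s≤s)
open import Data.Nat.Divisibility using (_∤_; divides; divides-refl; ∣1⇒≡1)
open import Data.Nat.Primality using (Prime; prime[2]; euclidsLemma; prime⇒nonTrivial)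
import Data.Nat.Properties as ℕ
open import Data.Product.Base using (∃; _×_; _,_; proj₁; proj₂)
import Data.Sign.Base as Sign
open import Data.Sum.Base using (inj₁; inj₂; [_,_]′)
open import Data.Vec.Functional using (Vector; removeAt; replicate)
open import Function.Base using (_∘_; case_of_; id)
open import Function.Bundles using (Bijection)
open import Function.Definitions using (Injective)
open import Relation.Binary.Consequences using (dec⇒weaklyDec)
open import Relation.Binary.Definitions using (Decidable)
open import Relation.Binary.PropositionalEquality as ≡ using (_≡_; _≢_)
import Relation.Binary.Reasoning.Setoid as ≈-Reasoning
open import Relation.Nullary.Decidable using (yes; no; map′; decidable-stable)
open import Relation.Nullary.Negation using (¬_; contradiction)

-- The roots come from a linearisation. For `d ≠ 0`, the substitution `Y = d φ(w) / w` turns the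
-- equation for `Y` into `φ(d) φ²(w) + d φ(w) + φ²(d) w = 0`, which is linear over the field with q
-- elements. It has the solution `w = 1` because the trace of `d` is zero, and the solution
-- `w = φ(b)` by expansion. Since `Y` depends only on the line through `w`, the plane spanned by
-- these two solutions yields q + 1 values, one for each of its lines: `w = 1` gives `d`, and
-- `w = x + φ(b)` gives the others.
--
-- Interpolation allows every computation to be made with values, where `φ` acts as a ring
-- homomorphism. The points needed are available: `F` has exactly the q of them that the additivity
-- of `φ` requires, and `K` has more than q + 1.
--
-- Distinctness is claimed for every factorisation, of whatever length, so the roots found have to
-- be matched with an arbitrary list of linear factors.

-- Coefficients in ℤ, whose equality computes, let the solver cancel x - x over
-- an abstract ring.
module IntegerSolver {c ℓ} (R : CommutativeRing c ℓ) where
  open CommutativeRing R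
  open import Algebra.Properties.Ring ring
    using (-0#≈0#; -‿involutive; -‿distribˡ-*; -‿distribʳ-*; -‿+-comm)
  open import Algebra.Properties.Semiring.Mult.TCOptimised semiring
    using (1+×; ×-homo-+; ×1-homo-*) renaming (_×_ to _·_)
  open import Algebra.Properties.AbelianGroup +-abelianGroup using (xyx⁻¹≈y)
  open ≈-Reasoning setoid

  -- The multiple is the optimised one, for which `1 · 1#` reduces to `1#`; so `con (+ 1)` stands
  -- for `1#` itself and `con (+ 2)` for `1# + 1#` in the equations solved below.
  ⟦_⟧ℤ : ℤ → Carrier
  ⟦ + n      ⟧ℤ = n · 1#
  ⟦ -[1+ n ] ⟧ℤ = - (suc n · 1#)

  private
    neg-homo : ∀ i → ⟦ ℤ.- i ⟧ℤ ≈ - ⟦ i ⟧ℤ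
    neg-homo (+ zero)  = sym -0#≈0#
    neg-homo +[1+ n ]  = refl
    neg-homo -[1+ n ]  = sym (-‿involutive _)

    cancel-1 : ∀ x y → x - y ≈ (1# + x) - (1# + y)
    cancel-1 x y = begin
      x - y                   ≈⟨ +-congʳ (xyx⁻¹≈y 1# x) ⟨
      (1# + x - 1#) - y       ≈⟨ +-assoc _ _ _ ⟩
      (1# + x) + (- 1# - y)   ≈⟨ +-congˡ (-‿+-comm 1# y) ⟩
      (1# + x) - (1# + y)     ∎

    ⊖-homo : ∀ m n → ⟦ m ⊖ n ⟧ℤ ≈ m · 1# - n · 1#
    ⊖-homo m       zero    = sym (trans (+-congˡ -0#≈0#) (+-identityʳ _))
    ⊖-homo zero    (suc n) = sym (+-identityˡ _)
    ⊖-homo (suc m) (suc n) = begin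
      ⟦ suc m ⊖ suc n ⟧ℤ                ≡⟨ ≡.cong ⟦_⟧ℤ (ℤ.[1+m]⊖[1+n]≡m⊖n m n) ⟩
      ⟦ m ⊖ n ⟧ℤ                        ≈⟨ ⊖-homo m n ⟩
      m · 1# - n · 1#                   ≈⟨ cancel-1 _ _ ⟩
      (1# + m · 1#) - (1# + n · 1#)     ≈⟨ +-cong (1+× m 1#) (-‿cong (1+× n 1#)) ⟨
      suc m · 1# - suc n · 1#           ∎

    +-homo : ∀ i j → ⟦ i ℤ.+ j ⟧ℤ ≈ ⟦ i ⟧ℤ + ⟦ j ⟧ℤ
    +-homo (+ m)    (+ n)    = ×-homo-+ 1# m n
    +-homo (+ m)    -[1+ n ] = ⊖-homo m (suc n)
    +-homo -[1+ m ] (+ n)    = trans (⊖-homo n (suc m)) (+-comm _ _)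
    +-homo -[1+ m ] -[1+ n ] = begin
      - (suc (suc (m ℕ.+ n)) · 1#)       ≡⟨ ≡.cong (λ k → - (suc k · 1#)) (ℕ.+-suc m n) ⟨
      - ((suc m ℕ.+ suc n) · 1#)         ≈⟨ -‿cong (×-homo-+ 1# (suc m) (suc n)) ⟩
      - (suc m · 1# + suc n · 1#)        ≈⟨ -‿+-comm _ _ ⟨
      - (suc m · 1#) - (suc n · 1#)      ∎

    -◃-homo : ∀ n → ⟦ Sign.- ◃ n ⟧ℤ ≈ - (n · 1#)
    -◃-homo zero    = sym -0#≈0#
    -◃-homo (suc n) = refl

    +◃-homo : ∀ n → ⟦ Sign.+ ◃ n ⟧ℤ ≈ n · 1#
    +◃-homo zero    = refl
    +◃-homo (suc n) = refl

    *-homo : ∀ i j → ⟦ i ℤ.* j ⟧ℤ ≈ ⟦ i ⟧ℤ * ⟦ j ⟧ℤ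
    *-homo (+ m)    (+ n)    = trans (+◃-homo (m ℕ.* n)) (×1-homo-* m n)
    *-homo (+ m)    -[1+ n ] = begin
      ⟦ Sign.- ◃ m ℕ.* suc n ⟧ℤ  ≈⟨ -◃-homo (m ℕ.* suc n) ⟩
      - ((m ℕ.* suc n) · 1#)     ≈⟨ -‿cong (×1-homo-* m (suc n)) ⟩
      - (m · 1# * suc n · 1#)    ≈⟨ -‿distribʳ-* _ _ ⟩
      m · 1# * - (suc n · 1#)    ∎
    *-homo -[1+ m ] (+ n)    = begin
      ⟦ Sign.- ◃ suc m ℕ.* n ⟧ℤ  ≈⟨ -◃-homo (suc m ℕ.* n) ⟩
      - ((suc m ℕ.* n) · 1#)     ≈⟨ -‿cong (×1-homo-* (suc m) n) ⟩
      - (suc m · 1# * n · 1#)    ≈⟨ -‿distribˡ-* _ _ ⟩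
      - (suc m · 1#) * n · 1#    ∎
    *-homo -[1+ m ] -[1+ n ] = begin
      (suc m ℕ.* suc n) · 1#               ≈⟨ ×1-homo-* (suc m) (suc n) ⟩
      suc m · 1# * suc n · 1#              ≈⟨ -‿involutive _ ⟨
      - (- (suc m · 1# * suc n · 1#))      ≈⟨ -‿cong (-‿distribˡ-* _ _) ⟩
      - (- (suc m · 1#) * suc n · 1#)      ≈⟨ -‿distribʳ-* _ _ ⟩
      - (suc m · 1#) * - (suc n · 1#)      ∎

    almostCommutativeRing : AlmostCommutativeRing c ℓ
    almostCommutativeRing = fromCommutativeRing R

    homomorphism : ℤ.+-*-rawRing -Raw-AlmostCommutative⟶ almostCommutativeRing
    homomorphism = record
      { ⟦_⟧    = ⟦_⟧ℤ
      ; +-homo = +-homo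
      ; *-homo = *-homo
      ; -‿homo = neg-homo
      ; 0-homo = refl
      ; 1-homo = refl
      }

  open Algebra.Solver.Ring ℤ.+-*-rawRing almostCommutativeRing homomorphism
    (λ i j → Maybe.map (reflexive ∘ ≡.cong ⟦_⟧ℤ) (dec⇒weaklyDec ℤ._≟_ i j))
    public using (solve; _:=_; _:+_; _:*_; _:-_; :-_; con)

-- Polynomials over a commutative ring: degree bounds and evaluation.

module PolynomialProperties {c ℓ} (R : CommutativeRing c ℓ) where
  open CommutativeRing R hiding (zero)
  open Polynomial rawRing
  open IntegerSolver R
  open RawSemiringDefinitions (RawRing.rawSemiring rawRing) using (_^_; product)
  open import Algebra.Properties.Group +-group using (ε⁻¹≈ε; x∙y⁻¹≈ε⇒x≈y)
  open ≈-Reasoning setoid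

  -- The length of a list says little about the degree, since trailing zeros are allowed; a bound on
  -- the nonzero coefficients replaces it. The case `n = 0` expresses that `f` is the zero
  -- polynomial.
  DegreeBelow : ℕ → Poly → Set ℓ
  DegreeBelow n f = ∀ i → n ℕ.≤ i → coeff f i ≈ 0#

  record Monic (n : ℕ) (f : Poly) : Set ℓ where
    constructor monic
    field
      lead  : coeff f n ≈ 1#
      below : DegreeBelow (suc n) f

  coeff-+ₚ : ∀ f g i → coeff (f +ₚ g) i ≈ coeff f i + coeff g i
  coeff-+ₚ []      g       i       = sym (+-identityˡ _)
  coeff-+ₚ (a ∷ f) []      i       = sym (+-identityʳ _)
  coeff-+ₚ (a ∷ f) (b ∷ g) zero    = refl
  coeff-+ₚ (a ∷ f) (b ∷ g) (suc i) = coeff-+ₚ f g i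

  coeff--ₚ : ∀ f i → coeff (-ₚ f) i ≈ - coeff f i
  coeff--ₚ []      i       = sym ε⁻¹≈ε
  coeff--ₚ (a ∷ f) zero    = refl
  coeff--ₚ (a ∷ f) (suc i) = coeff--ₚ f i

  coeff-map-* : ∀ a f i → coeff (map (a *_) f) i ≈ a * coeff f i
  coeff-map-* a []      i       = sym (zeroʳ a)
  coeff-map-* a (b ∷ f) zero    = refl
  coeff-map-* a (b ∷ f) (suc i) = coeff-map-* a f i

  coeff-*ₚ : ∀ a f g i → coeff ((a ∷ f) *ₚ g) i ≈ a * coeff g i + coeff (0# ∷ (f *ₚ g)) i
  coeff-*ₚ a f g i =
    trans (coeff-+ₚ (map (a *_) g) (0# ∷ (f *ₚ g)) i) (+-congʳ (coeff-map-* a g i))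

  coeff-C*ₚ : ∀ a g i → coeff (C a *ₚ g) i ≈ a * coeff g i
  coeff-C*ₚ a g i = trans (coeff-*ₚ a [] g i) (trans (+-congˡ (coeff-0 i)) (+-identityʳ _))
    where
    coeff-0 : ∀ i → coeff (0# ∷ []) i ≈ 0#
    coeff-0 zero    = refl
    coeff-0 (suc i) = refl

  eval-0 : ∀ f x → DegreeBelow 0 f → eval f x ≈ 0#
  eval-0 []      x d = refl
  eval-0 (a ∷ f) x d = begin
    a + x * eval f x  ≈⟨ +-cong (d 0 z≤n) (*-congˡ (eval-0 f x (λ i _ → d (suc i) z≤n))) ⟩
    0# + x * 0#       ≈⟨ trans (+-identityˡ _) (zeroʳ x) ⟩
    0#                ∎

  eval-+ₚ : ∀ f g x → eval (f +ₚ g) x ≈ eval f x + eval g x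
  eval-+ₚ []      g       x = sym (+-identityˡ _)
  eval-+ₚ (a ∷ f) []      x = sym (+-identityʳ _)
  eval-+ₚ (a ∷ f) (b ∷ g) x = begin
    a + b + x * eval (f +ₚ g) x             ≈⟨ +-congˡ (*-congˡ (eval-+ₚ f g x)) ⟩
    a + b + x * (eval f x + eval g x)       ≈⟨ solve 5 (λ a b x u v →
      a :+ b :+ x :* (u :+ v) := (a :+ x :* u) :+ (b :+ x :* v)) refl a b x _ _ ⟩
    (a + x * eval f x) + (b + x * eval g x) ∎

  eval--ₚ : ∀ f x → eval (-ₚ f) x ≈ - eval f x
  eval--ₚ []      x = sym ε⁻¹≈ε
  eval--ₚ (a ∷ f) x = begin
    - a + x * eval (-ₚ f) x  ≈⟨ +-congˡ (*-congˡ (eval--ₚ f x)) ⟩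
    - a + x * - eval f x     ≈⟨ solve 3 (λ a x u → :- a :+ x :* :- u := :- (a :+ x :* u)) refl a x _ ⟩
    - (a + x * eval f x)     ∎

  eval-map-* : ∀ a f x → eval (map (a *_) f) x ≈ a * eval f x
  eval-map-* a []      x = sym (zeroʳ a)
  eval-map-* a (b ∷ f) x = begin
    a * b + x * eval (map (a *_) f) x  ≈⟨ +-congˡ (*-congˡ (eval-map-* a f x)) ⟩
    a * b + x * (a * eval f x)         ≈⟨ solve 4 (λ a b x u →
      a :* b :+ x :* (a :* u) := a :* (b :+ x :* u)) refl a b x _ ⟩
    a * (b + x * eval f x)             ∎

  eval-*ₚ : ∀ f g x → eval (f *ₚ g) x ≈ eval f x * eval g x
  eval-*ₚ []      g x = sym (zeroˡ _)
  eval-*ₚ (a ∷ f) g x = begin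
    eval (map (a *_) g +ₚ (0# ∷ (f *ₚ g))) x           ≈⟨ eval-+ₚ (map (a *_) g) _ x ⟩
    eval (map (a *_) g) x + (0# + x * eval (f *ₚ g) x)
      ≈⟨ +-cong (eval-map-* a g x) (+-congˡ (*-congˡ (eval-*ₚ f g x))) ⟩
    a * eval g x + (0# + x * (eval f x * eval g x))    ≈⟨ solve 4 (λ a x u v →
      a :* v :+ (con (+ 0) :+ x :* (u :* v)) := (a :+ x :* u) :* v) refl a x _ _ ⟩
    (a + x * eval f x) * eval g x                      ∎

  eval-C : ∀ a x → eval (C a) x ≈ a
  eval-C a x = trans (+-congˡ (zeroʳ x)) (+-identityʳ a)

  eval-linear : ∀ y x → eval (y ∷ 1# ∷ []) x ≈ y + x
  eval-linear y x = +-congˡ (trans (*-congˡ (eval-C 1# x)) (*-identityʳ x))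

  eval-X : ∀ x → eval X x ≈ x
  eval-X x = trans (eval-linear 0# x) (+-identityˡ x)

  eval-X- : ∀ r x → eval (X- r) x ≈ x - r
  eval-X- r x = begin
    eval (X- r) x             ≈⟨ eval-+ₚ X (-ₚ C r) x ⟩
    eval X x + eval (C (- r)) x ≈⟨ +-cong (eval-X x) (eval-C (- r) x) ⟩
    x - r                     ∎

  eval-^ₚ : ∀ f n x → eval (f ^ₚ n) x ≈ eval f x ^ n
  eval-^ₚ f zero    x = eval-C 1# x
  eval-^ₚ f (suc n) x = trans (eval-*ₚ f (f ^ₚ n) x) (*-congˡ (eval-^ₚ f n x))

  eval-∏ₚ : ∀ {n} (f : Vector Poly n) x → eval (∏ₚ f) x ≈ product (λ i → eval (f i) x)
  eval-∏ₚ {zero}  f x = eval-C 1# x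
  eval-∏ₚ {suc n} f x = trans (eval-*ₚ (f Fin.zero) (∏ₚ (f ∘ Fin.suc)) x) (*-congˡ (eval-∏ₚ (f ∘ Fin.suc) x))

  difference-below : ∀ f g n → (∀ i → n ℕ.≤ i → coeff f i ≈ coeff g i) → DegreeBelow n (f +ₚ -ₚ g)
  difference-below f g n f≈g i n≤i = begin
    coeff (f +ₚ -ₚ g) i         ≈⟨ coeff-+ₚ f (-ₚ g) i ⟩
    coeff f i + coeff (-ₚ g) i  ≈⟨ +-cong (f≈g i n≤i) (coeff--ₚ g i) ⟩
    coeff g i - coeff g i       ≈⟨ -‿inverseʳ _ ⟩
    0#                          ∎

  difference-vanishes : ∀ f g → DegreeBelow 0 (f +ₚ -ₚ g) → f ≈ₚ g
  difference-vanishes f g d = coeffwise λ i → x∙y⁻¹≈ε⇒x≈y _ _ (begin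
    coeff f i - coeff g i       ≈⟨ +-congˡ (coeff--ₚ g i) ⟨
    coeff f i + coeff (-ₚ g) i  ≈⟨ coeff-+ₚ f (-ₚ g) i ⟨
    coeff (f +ₚ -ₚ g) i         ≈⟨ d i z≤n ⟩
    0#                          ∎)

  eval-difference : ∀ f g x → eval (f +ₚ -ₚ g) x ≈ eval f x - eval g x
  eval-difference f g x = trans (eval-+ₚ f (-ₚ g) x) (+-congˡ (eval--ₚ g x))

  -- Lists related by `≈ₚ` may differ in length; passing to the difference leaves a single list of
  -- zeros to evaluate.
  eval-cong : ∀ {f g} → f ≈ₚ g → ∀ x → eval f x ≈ eval g x
  eval-cong {f} {g} (coeffwise f≈g) x = x∙y⁻¹≈ε⇒x≈y _ _ (begin
    eval f x - eval g x  ≈⟨ eval-difference f g x ⟨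
    eval (f +ₚ -ₚ g) x   ≈⟨ eval-0 (f +ₚ -ₚ g) x (difference-below f g 0 (λ i _ → f≈g i)) ⟩
    0#                   ∎)

  -- The quotient of f - f(r) by X - r, by Horner's scheme.
  quotient : Poly → Carrier → Poly
  quotient []      r = []
  quotient (a ∷ f) r = eval f r ∷ quotient f r

  eval-quotient : ∀ f r x → eval f x ≈ eval f r + (x - r) * eval (quotient f r) x
  eval-quotient []      r x = sym (trans (+-identityˡ _) (zeroʳ _))
  eval-quotient (a ∷ f) r x = begin
    a + x * eval f x                                         ≈⟨ +-congˡ (*-congˡ (eval-quotient f r x)) ⟩
    a + x * (eval f r + (x - r) * eval (quotient f r) x)     ≈⟨ solve 5 (λ a x r u v →
      a :+ x :* (u :+ (x :- r) :* v) := (a :+ r :* u) :+ (x :- r) :* (u :+ x :* v)) refl a x r _ _ ⟩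
    (a + r * eval f r) + (x - r) * (eval f r + x * eval (quotient f r) x) ∎

  quotient-below : ∀ n f r → DegreeBelow (suc n) f → DegreeBelow n (quotient f r)
  quotient-below n       []      r d i       _         = refl
  quotient-below zero    (a ∷ f) r d zero    _         = eval-0 f r (λ i _ → d (suc i) (s≤s z≤n))
  quotient-below zero    (a ∷ f) r d (suc i) _         =
    quotient-below zero f r (λ j _ → d (suc j) (s≤s z≤n)) i z≤n
  quotient-below (suc n) (a ∷ f) r d (suc i) (s≤s n≤i) =
    quotient-below n f r (λ j n<j → d (suc j) (s≤s n<j)) i n≤i

  root-of-constant : ∀ f r → DegreeBelow 1 f → IsRoot f r → DegreeBelow 0 f
  root-of-constant f       r d root (suc i) _ = d (suc i) (s≤s z≤n)
  root-of-constant []      r d root zero    _ = refl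
  root-of-constant (a ∷ f) r d root zero    _ = begin
    a                 ≈⟨ trans (+-congˡ (zeroʳ r)) (+-identityʳ a) ⟨
    a + r * 0#        ≈⟨ +-congˡ (*-congˡ (eval-0 f r λ i _ → d (suc i) (s≤s z≤n))) ⟨
    a + r * eval f r  ≈⟨ root ⟩
    0#                ∎

  -- The coefficients of the quotient are the values at `r` of the successive tails of `f`. If they
  -- all vanish, the first tail is by induction a constant, and it has the root `r`, so it is zero.
  quotient-vanishes : ∀ f r → DegreeBelow 0 (quotient f r) → DegreeBelow 1 f
  quotient-vanishes []      r d i       _ = refl
  quotient-vanishes (a ∷ f) r d (suc i) _ =
    root-of-constant f r (quotient-vanishes f r (λ i _ → d (suc i) z≤n)) (d 0 z≤n) i z≤n

  monic-cong : ∀ {m n f} → m ≡ n → Monic m f → Monic n f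
  monic-cong ≡.refl f-monic = f-monic

  monic-C1 : Monic 0 (C 1#)
  monic-C1 = monic refl λ { (suc i) _ → refl }

  -- The explicit list `a ∷ 1# ∷ []` covers all linear factors at once: both `X` and `X- r` reduce
  -- to this shape.
  monic-linear-*ₚ : ∀ {n} a f → Monic n f → Monic (suc n) ((a ∷ 1# ∷ []) *ₚ f)
  monic-linear-*ₚ {n} a f (monic f-lead f-below) = monic lead below
    where
    coeff-suc : ∀ i → coeff ((a ∷ 1# ∷ []) *ₚ f) (suc i) ≈ a * coeff f (suc i) + coeff f i
    coeff-suc i = begin
      coeff ((a ∷ 1# ∷ []) *ₚ f) (suc i)         ≈⟨ coeff-*ₚ a (1# ∷ []) f (suc i) ⟩
      a * coeff f (suc i) + coeff (C 1# *ₚ f) i  ≈⟨ +-congˡ (trans (coeff-C*ₚ 1# f i) (*-identityˡ _)) ⟩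
      a * coeff f (suc i) + coeff f i            ∎
    lead = begin
      coeff ((a ∷ 1# ∷ []) *ₚ f) (suc n)  ≈⟨ coeff-suc n ⟩
      a * coeff f (suc n) + coeff f n     ≈⟨ +-cong (*-congˡ (f-below (suc n) ℕ.≤-refl)) f-lead ⟩
      a * 0# + 1#                         ≈⟨ trans (+-congʳ (zeroʳ a)) (+-identityˡ 1#) ⟩
      1#                                  ∎
    below : DegreeBelow (suc (suc n)) ((a ∷ 1# ∷ []) *ₚ f)
    below (suc i) (s≤s n<i) = begin
      coeff ((a ∷ 1# ∷ []) *ₚ f) (suc i)  ≈⟨ coeff-suc i ⟩
      a * coeff f (suc i) + coeff f i     ≈⟨ +-cong (*-congˡ (f-below (suc i) (ℕ.m≤n⇒m≤1+n n<i))) (f-below i n<i) ⟩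
      a * 0# + 0#                         ≈⟨ trans (+-congʳ (zeroʳ a)) (+-identityˡ 0#) ⟩
      0#                                  ∎

  monic-linear-^ₚ : ∀ a n → Monic n ((a ∷ 1# ∷ []) ^ₚ n)
  monic-linear-^ₚ a zero    = monic-C1
  monic-linear-^ₚ a (suc n) = monic-linear-*ₚ a _ (monic-linear-^ₚ a n)

  monic-∏ₚ : ∀ {n} (r : Vector Carrier n) → Monic n (∏ₚ (λ i → X- r i))
  monic-∏ₚ {zero}  r = monic-C1
  monic-∏ₚ {suc n} r = monic-linear-*ₚ _ _ (monic-∏ₚ (r ∘ Fin.suc))

  C-below : ∀ x → DegreeBelow 1 (C x)
  C-below x (suc i) _ = refl

  X-below : DegreeBelow 2 X
  X-below (suc (suc i)) _ = refl
  X-below (suc zero) (s≤s ())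

  below-mono : ∀ {m n} f → m ℕ.≤ n → DegreeBelow m f → DegreeBelow n f
  below-mono f m≤n d i n≤i = d i (ℕ.≤-trans m≤n n≤i)

  +ₚ-below : ∀ {n} f g → DegreeBelow n f → DegreeBelow n g → DegreeBelow n (f +ₚ g)
  +ₚ-below f g df dg i n≤i =
    trans (coeff-+ₚ f g i) (trans (+-cong (df i n≤i) (dg i n≤i)) (+-identityˡ 0#))

  C*ₚ-below : ∀ {n} a f → DegreeBelow n f → DegreeBelow n (C a *ₚ f)
  C*ₚ-below a f d i n≤i = trans (coeff-C*ₚ a f i) (trans (*-congˡ (d i n≤i)) (zeroʳ a))

  monic-+ₚ : ∀ {n} f g → Monic n f → DegreeBelow n g → Monic n (f +ₚ g)
  monic-+ₚ {n} f g (monic f-lead f-below) g-below = monic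
    (trans (coeff-+ₚ f g n) (trans (+-cong f-lead (g-below n ℕ.≤-refl)) (+-identityʳ 1#)))
    (+ₚ-below f g f-below (below-mono g (ℕ.n≤1+n n) g-below))

  vanishing-*ₚ : ∀ f g → DegreeBelow 0 f → DegreeBelow 0 (f *ₚ g)
  vanishing-*ₚ []      g d i _ = refl
  vanishing-*ₚ (a ∷ f) g d i _ = begin
    coeff ((a ∷ f) *ₚ g) i                      ≈⟨ coeff-*ₚ a f g i ⟩
    a * coeff g i + coeff (0# ∷ (f *ₚ g)) i     ≈⟨ +-cong (*-congʳ (d 0 z≤n)) (shifted i) ⟩
    0# * coeff g i + 0#                         ≈⟨ trans (+-identityʳ _) (zeroˡ _) ⟩
    0#                                          ∎
    where
    shifted : ∀ i → coeff (0# ∷ (f *ₚ g)) i ≈ 0#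
    shifted zero    = refl
    shifted (suc i) = vanishing-*ₚ f g (λ j _ → d (suc j) z≤n) i z≤n

  -- A nonzero top coefficient of `f` would survive in the product, in degree at least `n`. For the
  -- induction, `a` times `g` contributes nothing above degree `n`, so the hypothesis passes from
  -- `a ∷ f` to its tail. This bounds the multiplicity of a root from above.
  multiple-of-monic-vanishes : ∀ {n} f g → Monic n g → DegreeBelow n (f *ₚ g) → DegreeBelow 0 f
  multiple-of-monic-vanishes         []      g _ _ i _ = refl
  multiple-of-monic-vanishes {n} (a ∷ f) g g-monic@(monic g-lead g-below) d = vanishes
    where
    coeff-tail : ∀ i → n ℕ.≤ i → coeff (f *ₚ g) i ≈ 0#
    coeff-tail i n≤i = begin
      coeff (f *ₚ g) i                         ≈⟨ trans (+-congʳ (zeroʳ a)) (+-identityˡ _) ⟨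
      a * 0# + coeff (f *ₚ g) i                ≈⟨ +-congʳ (*-congˡ (g-below (suc i) (s≤s n≤i))) ⟨
      a * coeff g (suc i) + coeff (f *ₚ g) i   ≈⟨ coeff-*ₚ a f g (suc i) ⟨
      coeff ((a ∷ f) *ₚ g) (suc i)             ≈⟨ d (suc i) (ℕ.m≤n⇒m≤1+n n≤i) ⟩
      0#                                       ∎
    f-vanishes : DegreeBelow 0 f
    f-vanishes = multiple-of-monic-vanishes f g g-monic coeff-tail
    shifted : ∀ i → coeff (0# ∷ (f *ₚ g)) i ≈ 0#
    shifted zero    = refl
    shifted (suc i) = vanishing-*ₚ f g f-vanishes i z≤n
    vanishes : DegreeBelow 0 (a ∷ f)
    vanishes (suc i) _ = f-vanishes i z≤n
    vanishes zero    _ = begin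
      a                                        ≈⟨ *-identityʳ a ⟨
      a * 1#                                   ≈⟨ *-congˡ g-lead ⟨
      a * coeff g n                            ≈⟨ +-identityʳ _ ⟨
      a * coeff g n + 0#                       ≈⟨ +-congˡ (shifted n) ⟨
      a * coeff g n + coeff (0# ∷ (f *ₚ g)) n  ≈⟨ coeff-*ₚ a f g n ⟨
      coeff ((a ∷ f) *ₚ g) n                   ≈⟨ d n ℕ.≤-refl ⟩
      0#                                       ∎

  -- Roots and interpolation without zero divisors.

  module _ (integral : ∀ {x y} → ¬ (x ≈ 0#) → x * y ≈ 0# → y ≈ 0#) where

    too-many-roots : ∀ {n} f (r : Vector Carrier n) → Injective _≡_ _≈_ r →
                     DegreeBelow n f → (∀ i → IsRoot f (r i)) → DegreeBelow 0 f
    too-many-roots {zero}  f r inj d _     = d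
    too-many-roots {suc n} f r inj d roots =
      root-of-constant f r₀ (quotient-vanishes f r₀ q-vanishes) (roots Fin.zero)
      where
      r₀ = r Fin.zero
      q = quotient f r₀
      q-root : ∀ i → IsRoot q (r (Fin.suc i))
      q-root i = integral (λ e → case inj (x∙y⁻¹≈ε⇒x≈y _ _ e) of λ ()) (begin
        (rᵢ - r₀) * eval q rᵢ                ≈⟨ +-identityˡ _ ⟨
        0# + (rᵢ - r₀) * eval q rᵢ           ≈⟨ +-congʳ (roots Fin.zero) ⟨
        eval f r₀ + (rᵢ - r₀) * eval q rᵢ    ≈⟨ eval-quotient f r₀ rᵢ ⟨
        eval f rᵢ                            ≈⟨ roots (Fin.suc i) ⟩
        0#                                   ∎)
        where
        rᵢ = r (Fin.suc i)
      q-vanishes : DegreeBelow 0 q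
      q-vanishes = too-many-roots q (r ∘ Fin.suc) (λ e → Fin.suc-injective (inj e))
                     (quotient-below n f r₀ d) q-root

    -- The leading terms cancel in the difference, so `n` points suffice in degree `n`. For the
    -- additivity of `φ` this matters: the degree is q and `F` has no more than q elements.
    monic-interpolation : ∀ {n f g} → Monic n f → Monic n g →
                          (r : Vector Carrier n) → Injective _≡_ _≈_ r →
                          (∀ i → eval f (r i) ≈ eval g (r i)) → f ≈ₚ g
    monic-interpolation {n} {f} {g} (monic f-lead f-below) (monic g-lead g-below) r inj agree =
      difference-vanishes f g (too-many-roots (f +ₚ -ₚ g) r inj
        (difference-below f g n same-coeff) root)
      where
      same-coeff : ∀ i → n ℕ.≤ i → coeff f i ≈ coeff g i
      same-coeff i n≤i with ℕ.m≤n⇒m<n∨m≡n n≤i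
      ... | inj₁ n<i    = trans (f-below i n<i) (sym (g-below i n<i))
      ... | inj₂ ≡.refl = trans f-lead (sym g-lead)
      root : ∀ i → IsRoot (f +ₚ -ₚ g) (r i)
      root i = begin
        eval (f +ₚ -ₚ g) (r i)         ≈⟨ eval-difference f g (r i) ⟩
        eval f (r i) - eval g (r i)    ≈⟨ +-congʳ (agree i) ⟩
        eval g (r i) - eval g (r i)    ≈⟨ -‿inverseʳ _ ⟩
        0#                             ∎

-- A missed value `j` could be punched out, leaving an injection into a set with fewer than `n`
-- elements, against the pigeonhole principle. The inequality instead of `m ≡ n` suits lists of
-- roots, where only a bound on the length is known beforehand.
injective⇒surjective : ∀ {m n} (f : Fin n → Fin m) → m ℕ.≤ n → Injective _≡_ _≡_ f →
                       ∀ j → ∃ λ i → f i ≡ j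
injective⇒surjective {suc m} f m<n inj j with Fin.any? (λ i → f i Fin.≟ j)
... | yes hit = hit
... | no miss with Fin.pigeonhole m<n (λ i → punchOut {i = j} {f i} (λ j≡ → miss (i , ≡.sym j≡)))
...   | i , k , i<k , eq =
        contradiction (inj (Fin.punchOut-injective {i = j} _ _ eq)) (Fin.<⇒≢ i<k)

-- Finite fields: inverses, characteristic and Fermat's theorem.

module FiniteFieldProperties {c ℓ₁ ℓ₂ n} (K : FiniteField c ℓ₁ ℓ₂ n) where
  open FiniteField K hiding (zero)
  open CommutativeRing commutativeRing
    using (+-commutativeMonoid; *-commutativeMonoid; semiring; +-group)
  open RawSemiringDefinitions (RawRing.rawSemiring rawRing) using (_^_; product; sum)
    renaming (_×_ to _·_)
  open import Algebra.Properties.Group +-group using (x∙y⁻¹≈ε⇒x≈y; identityʳ-unique)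
  open import Algebra.Apartness.Properties.HeytingCommutativeRing heytingCommutativeRing
    using (1#0; x-0≈x; invertibleˡ⇒#)
  open IntegerSolver commutativeRing
  open Algebra.Properties.Semiring.Exp semiring using (^-congˡ)
  open Bijection enumeration public using () renaming (to to element; injective to element-injective)
  open ≈-Reasoning setoid

  index : Carrier → Fin n
  index x = proj₁ (Bijection.surjective enumeration x)

  element-index : ∀ x → element (index x) ≈ x
  element-index x = proj₂ (Bijection.surjective enumeration x) ≡.refl

  index-cong : ∀ {x y} → x ≈ y → index x ≡ index y
  index-cong x≈y = element-injective (trans (element-index _) (trans x≈y (sym (element-index _))))

  index-injective : ∀ {x y} → index x ≡ index y → x ≈ y
  index-injective eq =
    trans (sym (element-index _)) (trans (reflexive (≡.cong element eq)) (element-index _))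

  infix 4 _≟_
  _≟_ : Decidable _≈_
  x ≟ y = map′ index-injective index-cong (index x Fin.≟ index y)

  #⇒≉ : ∀ {x y} → x # y → ¬ (x ≈ y)
  #⇒≉ x#y x≈y = proj₂ (tight _ _) x≈y x#y

  1≉0 : ¬ (1# ≈ 0#)
  1≉0 = #⇒≉ 1#0

  -- Tightness turns `x ≉ 0#` only into the double negation of `x # 0#`. Since `y ≈ 0#` is
  -- decidable, hence stable, the inverse of `x` may still be used to prove it.
  integral : ∀ {x y} → ¬ (x ≈ 0#) → x * y ≈ 0# → y ≈ 0#
  integral {x} {y} x≉0 xy≈0 = decidable-stable (y ≟ 0#) λ y≉0 →
    x≉0 (proj₁ (tight x 0#) λ x#0 → y≉0 (cancel (#⇒invertible x#0)))
    where
    cancel : (∃ λ z → z * (x - 0#) ≈ 1# × (x - 0#) * z ≈ 1#) → y ≈ 0#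
    cancel (z , zx≈1 , _) = begin
      y                   ≈⟨ *-identityˡ y ⟨
      1# * y              ≈⟨ *-congʳ zx≈1 ⟨
      z * (x - 0#) * y    ≈⟨ *-congʳ (*-congˡ (x-0≈x x)) ⟩
      z * x * y           ≈⟨ *-assoc z x y ⟩
      z * (x * y)         ≈⟨ *-congˡ xy≈0 ⟩
      z * 0#              ≈⟨ zeroʳ z ⟩
      0#                  ∎

  *-cancelˡ-≉0 : ∀ {x} → ¬ (x ≈ 0#) → ∀ {y z} → x * y ≈ x * z → y ≈ z
  *-cancelˡ-≉0 {x} x≉0 {y} {z} xy≈xz = x∙y⁻¹≈ε⇒x≈y y z (integral x≉0 (begin
    x * (y - z)    ≈⟨ solve 3 (λ x y z → x :* (y :- z) := x :* y :- x :* z) refl x y z ⟩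
    x * y - x * z  ≈⟨ +-congʳ xy≈xz ⟩
    x * z - x * z  ≈⟨ -‿inverseʳ _ ⟩
    0#             ∎))

  *-≉0 : ∀ {x y} → ¬ (x ≈ 0#) → ¬ (y ≈ 0#) → ¬ (x * y ≈ 0#)
  *-≉0 x≉0 y≉0 xy≈0 = y≉0 (integral x≉0 xy≈0)

  -- Multiplication by `x` is injective on a finite set, hence surjective, and reaches `1#`.
  -- Counting thus produces an inverse without an apartness proof, and `≉0⇒#` recovers apartness
  -- from it.
  inverse : ∀ {x} → ¬ (x ≈ 0#) → ∃ λ y → x * y ≈ 1#
  inverse {x} x≉0 with injective⇒surjective (λ i → index (x * element i)) ℕ.≤-refl
                         (λ eq → element-injective (*-cancelˡ-≉0 x≉0 (index-injective eq))) (index 1#)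
  ... | i , eq = element i , index-injective eq

  ≉0⇒# : ∀ {x} → ¬ (x ≈ 0#) → x # 0#
  ≉0⇒# {x} x≉0 = let y , xy≈1 = inverse x≉0 in
    invertibleˡ⇒# (y , trans (*-congˡ (x-0≈x x)) (trans (*-comm y x) xy≈1))

  module _ {m ℓ} (M : CommutativeMonoid m ℓ) where
    private module M = CommutativeMonoid M
    import Algebra.Properties.CommutativeMonoid.Sum M as ΣM

    -- The bijection `f` only reorders the enumerated elements. A general commutative monoid allows
    -- both the additive use in `n·1≈0` and the multiplicative use in `fermat`.
    sum-translate : (h : Carrier → M.Carrier) → (∀ {x y} → x ≈ y → h x M.≈ h y) →
                    (f g : Carrier → Carrier) →
                    (∀ {x y} → x ≈ y → f x ≈ f y) → (∀ {x y} → x ≈ y → g x ≈ g y) →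
                    (∀ x → f (g x) ≈ x) → (∀ x → g (f x) ≈ x) →
                    ΣM.sum (h ∘ element) M.≈ ΣM.sum (h ∘ f ∘ element)
    sum-translate h h-cong f g f-cong g-cong fg gf =
      M.trans (ΣM.sum-permute (h ∘ element) π) (ΣM.sum-cong-≋ {n} λ i → h-cong (element-index (f (element i))))
      where
      π : Permutation n n
      π = permutation (index ∘ f ∘ element) (index ∘ g ∘ element)
        (λ i → element-injective (trans (element-index _) (trans (f-cong (element-index _)) (fg _))))
        (λ i → element-injective (trans (element-index _) (trans (g-cong (element-index _)) (gf _))))

  -- Translation by `1#` permutes the field, so it preserves the sum of all elements, although it
  -- adds `1#` to each of the `n` terms.
  n·1≈0 : n · 1# ≈ 0#
  n·1≈0 = identityʳ-unique (sum element) (n · 1#) (begin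
    sum element + n · 1#              ≈⟨ +-congˡ (Σ+.sum-replicate n) ⟨
    sum element + sum (replicate n 1#) ≈⟨ Σ+.∑-distrib-+ element (replicate n 1#) ⟨
    sum (λ i → element i + 1#)         ≈⟨ sum-translate +-commutativeMonoid id id (_+ 1#) (_- 1#)
                                           +-congʳ +-congʳ
                                           (λ x → solve 2 (λ x y → x :- y :+ y := x) refl x 1#)
                                           (λ x → solve 2 (λ x y → x :+ y :- y := x) refl x 1#) ⟨
    sum element                       ∎)
    where import Algebra.Properties.CommutativeMonoid.Sum +-commutativeMonoid as Σ+

  -- If `1# + 1#` vanished, `k · 1#` would depend only on the parity of `k`; for odd `n` it would be
  -- `1#`, against `n·1≈0`.
  odd⇒2≉0 : 2 ∤ n → ¬ (1# + 1# ≈ 0#)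
  odd⇒2≉0 2∤n 2≈0 = contradiction n·1≈0 (odd n 2∤n)
    where
    odd : ∀ k → 2 ∤ k → ¬ (k · 1# ≈ 0#)
    odd zero          2∤0 _   = 2∤0 (divides-refl 0)
    odd (suc zero)    _   1≈0 = 1≉0 (trans (sym (+-identityʳ 1#)) 1≈0)
    odd (suc (suc k)) 2∤k eq  = odd k (λ { (divides l ≡.refl) → 2∤k (divides-refl (suc l)) }) (begin
      k · 1#                ≈⟨ +-identityˡ _ ⟨
      0# + k · 1#           ≈⟨ +-congʳ 2≈0 ⟨
      1# + 1# + k · 1#      ≈⟨ +-assoc _ _ _ ⟩
      1# + (1# + k · 1#)    ≈⟨ eq ⟩
      0#                    ∎)

  product-≉0 : ∀ {k} (v : Vector Carrier k) → (∀ i → ¬ (v i ≈ 0#)) → ¬ (product v ≈ 0#)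
  product-≉0 {zero}  v v≉0 = 1≉0
  product-≉0 {suc k} v v≉0 = *-≉0 (v≉0 Fin.zero) (product-≉0 (v ∘ Fin.suc) (v≉0 ∘ Fin.suc))

  private
    module Π = Algebra.Properties.CommutativeMonoid.Sum *-commutativeMonoid

    -- The extra factor `x` makes up for the entry `1#`, which avoids the exponent `k - 1`.
    product-const-except : ∀ {k} x (v : Vector Carrier k) i → v i ≈ 1# → (∀ j → j ≢ i → v j ≈ x) →
                           x * product v ≈ x ^ k
    product-const-except {suc k} x v i vᵢ≈1 v≈x = *-congˡ (begin
      product v                        ≈⟨ Π.sum-remove {i = i} v ⟩
      v i * product (removeAt v i)     ≈⟨ *-congʳ vᵢ≈1 ⟩
      1# * product (removeAt v i)      ≈⟨ *-identityˡ _ ⟩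
      product (removeAt v i)           ≈⟨ Π.sum-cong-≋ (λ j → v≈x _ (Fin.punchInᵢ≢i i j)) ⟩
      product (replicate k x)          ≈⟨ Π.sum-replicate k ⟩
      x ^ k                            ∎)

  -- The element of `Fin k` witnesses that the exponent is positive; the index of zero in a field of
  -- `k` elements provides one.
  0^n≈0 : ∀ {k} → Fin k → 0# ^ k ≈ 0#
  0^n≈0 {suc k} _ = zeroˡ _

  -- Multiplication by x ≠ 0 permutes the nonzero elements; in the products
  -- below the element 0 is replaced by 1.
  fermat : ∀ x → x ^ n ≈ x
  fermat x with x ≟ 0#
  ... | yes x≈0 = trans (^-congˡ n x≈0) (trans (0^n≈0 (index 0#)) (sym x≈0))
  ... | no  x≉0 = begin
    x ^ n            ≈⟨ product-const-except x w (index 0#) (w-0 (element-index 0#))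
                          (λ j j≢ → w-≉0 (λ e → j≢ (element-injective (trans e (sym (element-index 0#)))))) ⟨
    x * product w    ≈⟨ *-congˡ product-w≈1 ⟩
    x * 1#           ≈⟨ *-identityʳ x ⟩
    x                ∎
    where
    h : Carrier → Carrier
    h y with y ≟ 0#
    ... | yes _ = 1#
    ... | no  _ = y
    -- `w i` is the factor by which multiplication by `x` changes the term at `i` of the product:
    -- `x` in general, and `1#` at the element zero, which stays where it is.
    w : Vector Carrier n
    w i with element i ≟ 0#
    ... | yes _ = 1#
    ... | no  _ = x
    w-0 : ∀ {i} → element i ≈ 0# → w i ≈ 1#
    w-0 {i} eq with element i ≟ 0#
    ... | yes _  = refl
    ... | no neq = contradiction eq neq
    w-≉0 : ∀ {i} → ¬ (element i ≈ 0#) → w i ≈ x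
    w-≉0 {i} neq with element i ≟ 0#
    ... | yes eq = contradiction eq neq
    ... | no _   = refl
    h-cong : ∀ {y z} → y ≈ z → h y ≈ h z
    h-cong {y} {z} y≈z with y ≟ 0# | z ≟ 0#
    ... | yes _   | yes _   = refl
    ... | yes y≈0 | no z≉0  = contradiction (trans (sym y≈z) y≈0) z≉0
    ... | no y≉0  | yes z≈0 = contradiction (trans y≈z z≈0) y≉0
    ... | no _    | no _    = y≈z
    h-≉0 : ∀ y → ¬ (h y ≈ 0#)
    h-≉0 y with y ≟ 0#
    ... | yes _  = 1≉0
    ... | no y≉0 = y≉0
    h-x* : ∀ i → h (x * element i) ≈ w i * h (element i)
    h-x* i with element i ≟ 0# | x * element i ≟ 0#
    ... | yes _   | yes _    = sym (*-identityˡ 1#)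
    ... | yes y≈0 | no xy≉0  = contradiction (trans (*-congˡ y≈0) (zeroʳ x)) xy≉0
    ... | no y≉0  | yes xy≈0 = contradiction (integral x≉0 xy≈0) y≉0
    ... | no _    | no _     = refl
    x⁻¹ = proj₁ (inverse x≉0)
    xx⁻¹≈1 = proj₂ (inverse x≉0)
    cancel : ∀ {y z} → y * z ≈ 1# → ∀ t → y * (z * t) ≈ t
    cancel yz≈1 t = trans (sym (*-assoc _ _ t)) (trans (*-congʳ yz≈1) (*-identityˡ t))
    H = product (h ∘ element)
    product-w≈1 : product w ≈ 1#
    product-w≈1 = *-cancelˡ-≉0 (product-≉0 (h ∘ element) (h-≉0 ∘ element)) (begin
      H * product w                              ≈⟨ *-comm _ _ ⟩
      product w * H                              ≈⟨ Π.∑-distrib-+ w (h ∘ element) ⟨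
      product (λ i → w i * h (element i))        ≈⟨ Π.sum-cong-≋ h-x* ⟨
      product (λ i → h (x * element i))          ≈⟨ sum-translate *-commutativeMonoid h h-cong
                                                      (x *_) (x⁻¹ *_) *-congˡ *-congˡ
                                                      (cancel xx⁻¹≈1)
                                                      (cancel (trans (*-comm _ _) xx⁻¹≈1)) ⟨
      H                                          ≈⟨ *-identityʳ H ⟨
      H * 1#                                     ∎)

  ^-≉0 : ∀ {x} k → ¬ (x ≈ 0#) → ¬ (x ^ k ≈ 0#)
  ^-≉0 zero    x≉0 = 1≉0
  ^-≉0 (suc k) x≉0 = *-≉0 x≉0 (^-≉0 k x≉0)

  product≈0⇒ : ∀ {k} (v : Vector Carrier k) → product v ≈ 0# → ∃ λ i → v i ≈ 0#
  product≈0⇒ v Πv≈0 = decidable-stable (Fin.any? (λ i → v i ≟ 0#))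
    λ v≉0 → product-≉0 v (λ i vᵢ≈0 → v≉0 (i , vᵢ≈0)) Πv≈0

  ⇒product≈0 : ∀ {k} (v : Vector Carrier k) i → v i ≈ 0# → product v ≈ 0#
  ⇒product≈0 v Fin.zero    v₀≈0 = trans (*-congʳ v₀≈0) (zeroˡ _)
  ⇒product≈0 v (Fin.suc i) vᵢ≈0 = trans (*-congˡ (⇒product≈0 (v ∘ Fin.suc) i vᵢ≈0)) (zeroʳ _)

-- Factorisations into linear factors.

module Factorisation {c ℓ₁ ℓ₂ n} (K : FiniteField c ℓ₁ ℓ₂ n) where
  open FiniteField K hiding (zero)
  open CommutativeRing commutativeRing using (+-group)
  open RawSemiringDefinitions (RawRing.rawSemiring rawRing) using (product)
  open import Algebra.Properties.Group +-group using (x∙y⁻¹≈ε⇒x≈y)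
  open import Algebra.Apartness.Properties.HeytingCommutativeRing heytingCommutativeRing using (1#0)
  open FieldPolynomial K
  open PolynomialProperties commutativeRing
  open FiniteFieldProperties K
  open ≈-Reasoning setoid

  monic-factorisation : ∀ {k f} (r : Vector Carrier k) → f ≈ₚ ∏ₚ (λ i → X- r i) → IsFactorisation f r
  monic-factorisation r (coeffwise eq) = 1# , 1#0 , coeffwise λ i →
    trans (eq i) (sym (trans (coeff-C*ₚ 1# (∏ₚ (λ i → X- r i)) i) (*-identityˡ _)))

  factorisation⇒root : ∀ {k f} (r : Vector Carrier k) → IsFactorisation f r →
                       ∀ {x} → IsRoot f x → ∃ λ i → x ≈ r i
  factorisation⇒root {f = f} r (u , u#0 , f≈) {x} root =
    let i , eq = product≈0⇒ (λ i → eval (X- r i) x) Π≈0 in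
    i , x∙y⁻¹≈ε⇒x≈y x (r i) (trans (sym (eval-X- (r i) x)) eq)
    where
    Π≈0 : product (λ i → eval (X- r i) x) ≈ 0#
    Π≈0 = integral (#⇒≉ u#0) (begin
      u * product (λ i → eval (X- r i) x)           ≈⟨ *-cong (eval-C u x) (eval-∏ₚ (λ i → X- r i) x) ⟨
      eval (C u) x * eval (∏ₚ (λ i → X- r i)) x     ≈⟨ eval-*ₚ (C u) (∏ₚ (λ i → X- r i)) x ⟨
      eval (C u *ₚ ∏ₚ (λ i → X- r i)) x             ≈⟨ eval-cong f≈ x ⟨
      eval f x                                      ≈⟨ root ⟩
      0#                                            ∎)

  -- The right-hand side has the leading coefficient `u` in degree `k`, where `f` would vanish if
  -- `k` exceeded `m`.
  factorisation⇒length : ∀ {k m f} (r : Vector Carrier k) → Monic m f → IsFactorisation f r → k ℕ.≤ m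
  factorisation⇒length {k} {m} {f} r f-monic (u , u#0 , coeffwise f≈) = ℕ.≮⇒≥ λ m<k → #⇒≉ u#0 (begin
    u                                   ≈⟨ *-identityʳ u ⟨
    u * 1#                              ≈⟨ *-congˡ (Monic.lead (monic-∏ₚ r)) ⟨
    u * coeff (∏ₚ (λ i → X- r i)) k     ≈⟨ coeff-C*ₚ u (∏ₚ (λ i → X- r i)) k ⟨
    coeff (C u *ₚ ∏ₚ (λ i → X- r i)) k  ≈⟨ f≈ k ⟨
    coeff f k                           ≈⟨ Monic.below f-monic k m<k ⟩
    0#                                  ∎)

  simple-roots-factorisation : ∀ {k f} → Monic k f → (s : Vector Carrier k) → Injective _≡_ _≈_ s →
                               (∀ i → IsRoot f (s i)) → IsFactorisation f s
  simple-roots-factorisation f-monic s s-injective roots =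
    monic-factorisation s (monic-interpolation integral f-monic (monic-∏ₚ s) s s-injective λ i →
      trans (roots i) (sym (trans (eval-∏ₚ (λ j → X- s j) (s i))
        (⇒product≈0 _ i (trans (eval-X- (s i) (s i)) (-‿inverseʳ (s i)))))))

  -- Each known root `s j` occurs in `r`, at a position `σ j`, and `σ` is injective because `s` is.
  -- As `r` has at most `k` entries, `σ` is onto, so `r` is a reordering of `s`.
  simple-roots⇒RootsDistinct : ∀ {k f} → Monic k f → (s : Vector Carrier k) → Injective _≡_ _≈_ s →
                               (∀ i → IsRoot f (s i)) → RootsDistinct f
  simple-roots⇒RootsDistinct {k} {f} f-monic s s-injective roots {m} r factorisation {i} {j} rᵢ≈rⱼ =
    let i′ , σi′≡i = σ-surjective i
        j′ , σj′≡j = σ-surjective j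
        i′≡j′ = s-injective (begin
          s i′       ≈⟨ s≈r∘σ i′ ⟩
          r (σ i′)   ≡⟨ ≡.cong r σi′≡i ⟩
          r i        ≈⟨ rᵢ≈rⱼ ⟩
          r j        ≡⟨ ≡.cong r σj′≡j ⟨
          r (σ j′)   ≈⟨ s≈r∘σ j′ ⟨
          s j′       ∎)
    in ≡.trans (≡.sym σi′≡i) (≡.trans (≡.cong σ i′≡j′) σj′≡j)
    where
    σ : Fin k → Fin m
    σ j = proj₁ (factorisation⇒root r factorisation (roots j))
    s≈r∘σ : ∀ j → s j ≈ r (σ j)
    s≈r∘σ j = proj₂ (factorisation⇒root r factorisation (roots j))
    σ-injective : Injective _≡_ _≡_ σ
    σ-injective {j} {l} eq = s-injective (trans (s≈r∘σ j) (trans (reflexive (≡.cong r eq)) (sym (s≈r∘σ l))))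
    σ-surjective : ∀ j → ∃ λ i → σ i ≡ j
    σ-surjective = injective⇒surjective σ (factorisation⇒length r f-monic factorisation) σ-injective

-- Odd prime powers.

prime∤^ : ∀ {p m} → Prime p → p ∤ m → ∀ n → p ∤ m ℕ.^ n
prime∤^ {p} p-prime p∤m zero p∣1 with ∣1⇒≡1 p∣1
... | ≡.refl = contradiction p-prime λ ()
prime∤^ {p} {m} p-prime p∤m (suc n) p∣ =
  [ p∤m , prime∤^ p-prime p∤m n ]′ (euclidsLemma m (m ℕ.^ n) p-prime p∣)

oddPrimePower⇒odd : ∀ {q} → IsOddPrimePower q → 2 ∤ q
oddPrimePower⇒odd (p , n , _ , 2∤p , _ , ≡.refl) = prime∤^ prime[2] 2∤p n

oddPrimePower⇒≥2 : ∀ {q} → IsOddPrimePower q → 2 ℕ.≤ q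
oddPrimePower⇒≥2 (p , suc n , p-prime , _ , _ , ≡.refl) = begin
  2               ≤⟨ p≥2 ⟩
  p               ≡⟨ ℕ.*-identityʳ p ⟨
  p ℕ.* 1         ≤⟨ ℕ.*-monoʳ-≤ p (ℕ.m^n>0 p n) ⟩
  p ℕ.* p ℕ.^ n   ∎
  where
  open ℕ.≤-Reasoning
  p≥2 : 2 ℕ.≤ p
  p≥2 = ℕ.nonTrivial⇒n>1 p {{prime⇒nonTrivial p-prime}}
  instance
    p-nonZero : ℕ.NonZero p
    p-nonZero = ℕ.>-nonZero (ℕ.<-trans (s≤s z≤n) p≥2)

-- The map x ↦ x^q on `K` and its fixed field.

module Frobenius {c ℓ₁ ℓ₂ d m₁ m₂} (q : ℕ) (2≤q : 2 ℕ.≤ q)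
  (F : FiniteField c ℓ₁ ℓ₂ q) (K : FiniteField d m₁ m₂ (q ℕ.^ 3)) (ι : Embedding F K) where

  open FiniteField K hiding (zero)
  open CommutativeRing commutativeRing using (semiring; commutativeSemiring; +-group)
  open RawSemiringDefinitions (RawRing.rawSemiring rawRing) using (_^_)
  open Algebra.Properties.Semiring.Exp semiring using (^-congˡ; ^-assocʳ)
  open Algebra.Properties.CommutativeSemiring.Exp commutativeSemiring using (^-distrib-*)
  open import Algebra.Properties.Group +-group using (inverseˡ-unique)
  open Embedding ι
  open Polynomial rawRing
  open PolynomialProperties commutativeRing
  open FiniteFieldProperties K
  open ≈-Reasoning setoid
  private
    module F where
      open FiniteField F public
      open FiniteFieldProperties F public
      open RawSemiringDefinitions (RawRing.rawSemiring (FiniteField.rawRing F)) public using (_^_)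
  open RingMorphisms.IsRingMonomorphism isRingMonomorphism
    using (+-homo; *-homo; 1#-homo; ⟦⟧-cong) renaming (injective to ⟦⟧-injective)

  φ : Carrier → Carrier
  φ x = x ^ q

  φ-cong : ∀ {x y} → x ≈ y → φ x ≈ φ y
  φ-cong = ^-congˡ q

  φ-* : ∀ x y → φ (x * y) ≈ φ x * φ y
  φ-* x y = ^-distrib-* x y q

  φ² : ∀ x → x ^ (q ℕ.^ 2) ≈ φ (φ x)
  φ² x = begin
    x ^ (q ℕ.^ 2)  ≡⟨ ≡.cong (λ k → x ^ (q ℕ.* k)) (ℕ.*-identityʳ q) ⟩
    x ^ (q ℕ.* q)  ≈⟨ ^-assocʳ x q q ⟨
    φ (φ x)        ∎

  φ³ : ∀ x → φ (φ (φ x)) ≈ x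
  φ³ x = begin
    φ (φ (φ x))          ≈⟨ φ² (φ x) ⟨
    φ x ^ (q ℕ.^ 2)      ≈⟨ ^-assocʳ x q (q ℕ.^ 2) ⟩
    x ^ (q ℕ.^ 3)        ≈⟨ fermat x ⟩
    x                    ∎

  ⟦⟧-^ : ∀ y k → ⟦ y F.^ k ⟧ ≈ ⟦ y ⟧ ^ k
  ⟦⟧-^ y zero    = 1#-homo
  ⟦⟧-^ y (suc k) = trans (*-homo y (y F.^ k)) (*-congˡ (⟦⟧-^ y k))

  φ-⟦⟧ : ∀ y → φ ⟦ y ⟧ ≈ ⟦ y ⟧
  φ-⟦⟧ y = trans (sym (⟦⟧-^ y q)) (⟦⟧-cong (F.fermat y))

  image⇒fixed : ∀ {x} → x ∈Image → φ x ≈ x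
  image⇒fixed (y , eq) = trans (φ-cong (sym eq)) (trans (φ-⟦⟧ y) eq)

  base : Vector Carrier q
  base i = ⟦ F.element i ⟧

  base-injective : Injective _≡_ _≈_ base
  base-injective = F.element-injective ∘ ⟦⟧-injective

  φ-1 : φ 1# ≈ 1#
  φ-1 = image⇒fixed (F.1# , 1#-homo)

  private
    1≤q : 1 ℕ.≤ q
    1≤q = ℕ.<⇒≤ 2≤q

  -- Interpolation on F: both sides are monic of degree q in x.
  φ-+-from-base : ∀ y → (∀ i → φ (y + base i) ≈ φ y + φ (base i)) → ∀ x → φ (y + x) ≈ φ y + φ x
  φ-+-from-base y additive x = begin
    φ (y + x)   ≈⟨ eval-P x ⟨
    eval P x    ≈⟨ eval-cong P≈Q x ⟩
    eval Q x    ≈⟨ eval-Q x ⟩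
    φ y + φ x   ∎
    where
    P = (y ∷ 1# ∷ []) ^ₚ q
    Q = X ^ₚ q +ₚ C (φ y)
    eval-P : ∀ x → eval P x ≈ φ (y + x)
    eval-P x = trans (eval-^ₚ (y ∷ 1# ∷ []) q x) (φ-cong (eval-linear y x))
    eval-Q : ∀ x → eval Q x ≈ φ y + φ x
    eval-Q x = begin
      eval Q x                           ≈⟨ eval-+ₚ (X ^ₚ q) (C (φ y)) x ⟩
      eval (X ^ₚ q) x + eval (C (φ y)) x ≈⟨ +-cong (trans (eval-^ₚ X q x) (φ-cong (eval-X x))) (eval-C (φ y) x) ⟩
      φ x + φ y                          ≈⟨ +-comm _ _ ⟩
      φ y + φ x                          ∎
    P≈Q : P ≈ₚ Q
    P≈Q = monic-interpolation integral (monic-linear-^ₚ y q)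
      (monic-+ₚ (X ^ₚ q) (C (φ y)) (monic-linear-^ₚ 0# q) (below-mono (C (φ y)) 1≤q (C-below (φ y))))
      base base-injective
      (λ i → trans (eval-P (base i)) (trans (additive i) (sym (eval-Q (base i)))))

  -- Interpolation is applied twice. Additivity on `F`, where `φ` is the identity, gives it for one
  -- summand in `F` and the other arbitrary; exchanging the summands, this is the hypothesis for two
  -- arbitrary ones.
  φ-+ : ∀ x y → φ (x + y) ≈ φ x + φ y
  φ-+ x = φ-+-from-base x λ i → begin
    φ (x + base i)      ≈⟨ φ-cong (+-comm _ _) ⟩
    φ (base i + x)      ≈⟨ φ-+-from-base (base i) (additive-on-base i) x ⟩
    φ (base i) + φ x    ≈⟨ +-comm _ _ ⟩
    φ x + φ (base i)    ∎
    where
    additive-on-base : ∀ i j → φ (base i + base j) ≈ φ (base i) + φ (base j)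
    additive-on-base i j = begin
      φ (base i + base j)                      ≈⟨ image⇒fixed (_ , +-homo (F.element i) (F.element j)) ⟩
      base i + base j                          ≈⟨ +-cong (φ-⟦⟧ _) (φ-⟦⟧ _) ⟨
      φ (base i) + φ (base j)                  ∎

  φ-0 : φ 0# ≈ 0#
  φ-0 = 0^n≈0 (F.index F.0#)

  φ-neg : ∀ x → φ (- x) ≈ - φ x
  φ-neg x = inverseˡ-unique _ _
    (trans (sym (φ-+ (- x) x)) (trans (φ-cong (-‿inverseˡ x)) φ-0))

  -- The fixed points are the roots of `X^q - X`, and the q elements of `F` are already roots. One
  -- more would force this polynomial to be zero, although `2≤q` makes it monic of degree q.
  fixed⇒image : ∀ {x} → φ x ≈ x → x ∈Image
  fixed⇒image {x} φx≈x with Fin.any? (λ i → base i ≟ x)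
  ... | yes (i , eq) = F.element i , eq
  ... | no  x∉F      = contradiction (trans (sym (Monic.lead P-monic)) (P-vanishes q z≤n)) 1≉0
    where
    P = X ^ₚ q +ₚ -ₚ X
    -X-below : DegreeBelow q (-ₚ X)
    -X-below = below-mono (-ₚ X) 2≤q λ { (suc (suc i)) _ → refl ; (suc zero) (s≤s ()) }
    P-monic : Monic q P
    P-monic = monic-+ₚ (X ^ₚ q) (-ₚ X) (monic-linear-^ₚ 0# q) -X-below
    P-root : ∀ {y} → φ y ≈ y → IsRoot P y
    P-root {y} φy≈y = begin
      eval P y                   ≈⟨ eval-difference (X ^ₚ q) X y ⟩
      eval (X ^ₚ q) y - eval X y ≈⟨ +-cong (trans (eval-^ₚ X q y) (φ-cong (eval-X y))) (-‿cong (eval-X y)) ⟩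
      φ y - y                    ≈⟨ +-congʳ φy≈y ⟩
      y - y                      ≈⟨ -‿inverseʳ y ⟩
      0#                         ∎
    roots : Vector Carrier (suc q)
    roots Fin.zero    = x
    roots (Fin.suc i) = base i
    roots-injective : Injective _≡_ _≈_ roots
    roots-injective {Fin.zero}  {Fin.zero}  _  = ≡.refl
    roots-injective {Fin.zero}  {Fin.suc j} eq = contradiction (j , sym eq) x∉F
    roots-injective {Fin.suc i} {Fin.zero}  eq = contradiction (i , eq) x∉F
    roots-injective {Fin.suc i} {Fin.suc j} eq = ≡.cong Fin.suc (base-injective eq)
    P-vanishes : DegreeBelow 0 P
    P-vanishes = too-many-roots integral P roots roots-injective (Monic.below P-monic)
      λ { Fin.zero → P-root φx≈x ; (Fin.suc i) → P-root (φ-⟦⟧ _) }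

-- The polynomial `fₐ`: values, constant term and roots.

module RootsOfFₐ {c ℓ₁ ℓ₂ d m₁ m₂} (q : ℕ) (q-power : IsOddPrimePower q)
  (F : FiniteField c ℓ₁ ℓ₂ q) (K : FiniteField d m₁ m₂ (q ℕ.^ 3)) (ι : Embedding F K)
  (a : FiniteField.Carrier K) (a#0 : FiniteField._#_ K a (FiniteField.0# K)) where

  private
    2≤q : 2 ℕ.≤ q
    2≤q = oddPrimePower⇒≥2 q-power
    1≤q : 1 ℕ.≤ q
    1≤q = ℕ.<⇒≤ 2≤q

  open FiniteField K hiding (zero)
  open CommutativeRing commutativeRing using (semiring; +-group)
  open RawSemiringDefinitions (RawRing.rawSemiring rawRing) using (_^_) renaming (_×_ to _·_)
  open Algebra.Properties.Semiring.Exp semiring using (^-congˡ; ^-homo-*)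
  open import Algebra.Properties.Group +-group
    using (⁻¹-involutive; x∙y⁻¹≈ε⇒x≈y; x≈y⇒x∙y⁻¹≈ε; inverseˡ-unique; ∙-cancelˡ)
  open import Algebra.Apartness.Properties.HeytingCommutativeRing heytingCommutativeRing using (x-0≈x)
  open Embedding ι using (_∈Image)
  open FieldPolynomial K
  open Fₐ q K
  open RawMagmaDefinitions (RawRing.*-rawMagma polyRawRing) using (_,_)
  open IntegerSolver commutativeRing
  open PolynomialProperties commutativeRing
  open FiniteFieldProperties K
  open Factorisation K
  open Frobenius q 2≤q F K ι
  open ≈-Reasoning setoid

  f : Poly
  f = fₐ a a#0

  b b₁ b₂ a₁ a₂ : Carrier
  b  = inv a#0
  b₁ = φ b
  b₂ = φ b₁
  a₁ = φ a
  a₂ = φ a₁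

  ab≈1 : a * b ≈ 1#
  ab≈1 = trans (sym (*-congʳ (x-0≈x a))) (proj₂ (proj₂ (#⇒invertible a#0)))

  φ-inverse : ∀ {x y} → x * y ≈ 1# → φ x * φ y ≈ 1#
  φ-inverse xy≈1 = trans (sym (φ-* _ _)) (trans (φ-cong xy≈1) φ-1)

  inverse-fixed : ∀ {x y} → x * y ≈ 1# → φ x ≈ x → φ y ≈ y
  inverse-fixed {x} {y} xy≈1 φx≈x = *-cancelˡ-≉0 x≉0 (begin
    x * φ y    ≈⟨ *-congʳ φx≈x ⟨
    φ x * φ y  ≈⟨ φ-inverse xy≈1 ⟩
    1#         ≈⟨ xy≈1 ⟨
    x * y      ∎)
    where
    x≉0 : ¬ (x ≈ 0#)
    x≉0 x≈0 = 1≉0 (trans (sym xy≈1) (trans (*-congʳ x≈0) (zeroˡ y)))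

  b≉0 : ¬ (b ≈ 0#)
  b≉0 b≈0 = 1≉0 (trans (sym ab≈1) (trans (*-congˡ b≈0) (zeroʳ a)))

  -- `N b` is the product of the conjugates of `b`, and each of the terms `a₁`, `a₂` and `- a` that
  -- remain of `Tr a - 2 · a` cancels the matching conjugate.
  constant-term : N b * (Tr a - 2 · a) ≈ b * b₂ + b * b₁ - b₁ * b₂
  constant-term = begin
    N b * (Tr a - 2 · a)
      ≈⟨ *-cong (*-congˡ (trans (^-homo-* b q (q ℕ.^ 2)) (*-congˡ (φ² b)))) (+-congʳ (+-congˡ (φ² a))) ⟩
    b * (b₁ * b₂) * (a + a₁ + a₂ - 2 · a)
      -- Here `2 · a` unfolds to `a + (a + 0#)`, a shape that the left-hand side must reproduce.
      ≈⟨ solve 6 (λ a a₁ a₂ b b₁ b₂ →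
           b :* (b₁ :* b₂) :* (a :+ a₁ :+ a₂ :- (a :+ (a :+ con (+ 0))))
           := (a₁ :* b₁) :* (b :* b₂) :+ (a₂ :* b₂) :* (b :* b₁) :- (a :* b) :* (b₁ :* b₂))
         refl a a₁ a₂ b b₁ b₂ ⟩
    (a₁ * b₁) * (b * b₂) + (a₂ * b₂) * (b * b₁) - (a * b) * (b₁ * b₂)
      ≈⟨ +-cong (+-cong (1*-cong a₁b₁≈1) (1*-cong (φ-inverse a₁b₁≈1))) (-‿cong (1*-cong ab≈1)) ⟩
    b * b₂ + b * b₁ - b₁ * b₂ ∎
    where
    a₁b₁≈1 = φ-inverse ab≈1
    1*-cong : ∀ {x y} → x ≈ 1# → x * y ≈ y
    1*-cong x≈1 = trans (*-congʳ x≈1) (*-identityˡ _)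

  f-monic : Monic (suc q) f
  f-monic =
    monic-+ₚ (X ^ₚ (q ℕ.+ 1) +ₚ C b *ₚ (X ^ₚ q +ₚ X)) (C _)
      (monic-+ₚ (X ^ₚ (q ℕ.+ 1)) (C b *ₚ (X ^ₚ q +ₚ X))
        (monic-cong (ℕ.+-comm q 1) (monic-linear-^ₚ 0# (q ℕ.+ 1)))
        (C*ₚ-below b (X ^ₚ q +ₚ X) (+ₚ-below (X ^ₚ q) X
          (Monic.below (monic-linear-^ₚ 0# q))
          (below-mono X (s≤s 1≤q) X-below))))
      (below-mono (C _) (s≤s z≤n) (C-below _))

  -- The constant term is kept as a product, so that `f-root⇒≉0` can cancel the nonzero norm from
  -- it.
  eval-f₀ : ∀ x → eval f x ≈ x * φ x + b * (φ x + x) + N b * (Tr a - 2 · a)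
  eval-f₀ x = begin
    eval f x
      ≈⟨ eval-+ₚ (X ^ₚ (q ℕ.+ 1) +ₚ C b *ₚ (X ^ₚ q +ₚ X)) (C _) x ⟩
    eval (X ^ₚ (q ℕ.+ 1) +ₚ C b *ₚ (X ^ₚ q +ₚ X)) x + eval (C _) x
      ≈⟨ +-cong (trans (eval-+ₚ (X ^ₚ (q ℕ.+ 1)) (C b *ₚ (X ^ₚ q +ₚ X)) x) (+-cong leading middle)) (eval-C _ x) ⟩
    x * φ x + b * (φ x + x) + N b * (Tr a - 2 · a) ∎
    where
    power : ∀ k → eval (X ^ₚ k) x ≈ x ^ k
    power k = trans (eval-^ₚ X k x) (^-congˡ k (eval-X x))
    leading : eval (X ^ₚ (q ℕ.+ 1)) x ≈ x * φ x
    leading = trans (power (q ℕ.+ 1)) (reflexive (≡.cong (x ^_) (ℕ.+-comm q 1)))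
    middle : eval (C b *ₚ (X ^ₚ q +ₚ X)) x ≈ b * (φ x + x)
    middle = trans (eval-*ₚ (C b) (X ^ₚ q +ₚ X) x)
      (*-cong (eval-C b x) (trans (eval-+ₚ (X ^ₚ q) X x) (+-cong (power q) (eval-X x))))

  eval-f : ∀ x → eval f x ≈ x * φ x + b * (φ x + x) + (b * b₂ + b * b₁ - b₁ * b₂)
  eval-f x = trans (eval-f₀ x) (+-congˡ constant-term)

  -- f(0) = 0 gives a = φ(a) + φ²(a); adding the image of this under φ yields 2 φ²(a) = 0.
  f-root⇒≉0 : ∀ x → IsRoot f x → ¬ (x ≈ 0#)
  f-root⇒≉0 x root x≈0 = a₂≉0 (integral (odd⇒2≉0 (prime∤^ prime[2] (oddPrimePower⇒odd q-power) 3)) (begin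
    (1# + 1#) * a₂
      ≈⟨ solve 3 (λ a a₁ a₂ → con (+ 2) :* a₂
           := (a :+ a₁ :+ a₂ :- (a :+ (a :+ con (+ 0)))) :+ (a₂ :+ a :- a₁)) refl a a₁ a₂ ⟩
    (a + a₁ + a₂ - 2 · a) + (a₂ + a - a₁)
      ≈⟨ +-cong trace≈ (trans (+-congˡ (-‿cong a₁≈)) (-‿inverseʳ _)) ⟩
    0# + 0#
      ≈⟨ +-identityˡ 0# ⟩
    0# ∎))
    where
    a₂≉0 : ¬ (a₂ ≈ 0#)
    a₂≉0 = ^-≉0 q (^-≉0 q (#⇒≉ a#0))
    constant≈0 : N b * (Tr a - 2 · a) ≈ 0#
    constant≈0 = begin
      N b * (Tr a - 2 · a)                             ≈⟨ +-identityˡ _ ⟨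
      0# + N b * (Tr a - 2 · a)                        ≈⟨ +-congʳ vanishing ⟨
      x * φ x + b * (φ x + x) + N b * (Tr a - 2 · a)   ≈⟨ eval-f₀ x ⟨
      eval f x                                         ≈⟨ root ⟩
      0#                                               ∎
      where
      vanishing : x * φ x + b * (φ x + x) ≈ 0#
      vanishing = begin
        x * φ x + b * (φ x + x)    ≈⟨ +-cong (*-congʳ x≈0) (*-congˡ (+-cong (trans (φ-cong x≈0) φ-0) x≈0)) ⟩
        0# * φ x + b * (0# + 0#)   ≈⟨ solve 2 (λ y b →
          con (+ 0) :* y :+ b :* (con (+ 0) :+ con (+ 0)) := con (+ 0)) refl (φ x) b ⟩
        0#                         ∎
    trace≈ : a + a₁ + a₂ - 2 · a ≈ 0#
    trace≈ = trans (+-congʳ (+-congˡ (sym (φ² a)))) (integral (^-≉0 (1 ℕ.+ q ℕ.+ q ℕ.^ 2) b≉0) constant≈0)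
    a≈ : a ≈ a₁ + a₂
    a≈ = sym (x∙y⁻¹≈ε⇒x≈y (a₁ + a₂) a (trans
      (solve 3 (λ a a₁ a₂ → (a₁ :+ a₂ :- a) := (a :+ a₁ :+ a₂ :- (a :+ (a :+ con (+ 0))))) refl a a₁ a₂) trace≈))
    a₁≈ : a₁ ≈ a₂ + a
    a₁≈ = trans (φ-cong a≈) (trans (φ-+ a₁ a₂) (+-congˡ (φ³ a)))

  -- The case of `a` fixed by `φ`: a single root.

  module Fixed (φa≈a : φ a ≈ a) where
    b₁≈b : b₁ ≈ b
    b₁≈b = inverse-fixed ab≈1 φa≈a

    r : Carrier
    r = - b

    P : Poly
    P = (X- r) ^ₚ suc q

    eval-P : ∀ x → eval P x ≈ (x - r) ^ suc q
    eval-P x = trans (eval-^ₚ (X- r) (suc q) x) (^-congˡ (suc q) (eval-X- r x))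

    eval-f≈eval-P : ∀ x → eval f x ≈ eval P x
    eval-f≈eval-P x = begin
      eval f x
        ≈⟨ eval-f x ⟩
      x * φ x + b * (φ x + x) + (b * b₂ + b * b₁ - b₁ * b₂)
        ≈⟨ +-congˡ (+-cong (+-cong (*-congˡ b₂≈b) (*-congˡ b₁≈b)) (-‿cong (*-cong b₁≈b b₂≈b))) ⟩
      x * φ x + b * (φ x + x) + (b * b + b * b - b * b)
        ≈⟨ solve 3 (λ x y b → x :* y :+ b :* (y :+ x) :+ (b :* b :+ b :* b :- b :* b)
                              := (x :- :- b) :* (y :+ b)) refl x (φ x) b ⟩
      (x - r) * (φ x + b)       ≈⟨ *-congˡ (+-congˡ b₁≈b) ⟨
      (x - r) * (φ x + b₁)      ≈⟨ *-congˡ (φ-+ x b) ⟨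
      (x - r) * φ (x + b)       ≈⟨ *-congˡ (φ-cong (+-congˡ (⁻¹-involutive b))) ⟨
      (x - r) ^ suc q           ≈⟨ eval-P x ⟨
      eval P x                  ∎
      where
      b₂≈b : b₂ ≈ b
      b₂≈b = trans (φ-cong b₁≈b) b₁≈b

    f≈P : f ≈ₚ P
    f≈P = monic-interpolation integral f-monic (monic-linear-^ₚ _ (suc q))
      -- The two sides agree on all of `K`; the interpolation points are simply the first q + 1 of
      -- its q^3 elements.
      (λ i → element (Fin.inject≤ i q<q³))
      (λ eq → Fin.inject≤-injective q<q³ q<q³ _ _ (element-injective eq))
      (λ i → eval-f≈eval-P _)
      where
      q<q³ : q ℕ.< q ℕ.^ 3
      q<q³ = ≡.subst (ℕ._< q ℕ.^ 3) (ℕ.*-identityʳ q) (ℕ.^-monoʳ-< q 2≤q {1} {3} (s≤s (s≤s z≤n)))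

    splits : Splits f
    splits = suc q , (λ _ → r) , monic-factorisation {suc q} (λ _ → r) (≡.subst (f ≈ₚ_) (power≡∏ (suc q)) f≈P)
      where
      power≡∏ : ∀ k → (X- r) ^ₚ k ≡ ∏ₚ {k} (λ _ → X- r)
      power≡∏ zero    = ≡.refl
      power≡∏ (suc k) = ≡.cong ((X- r) *ₚ_) (power≡∏ k)

    single-root : HasSingleRoot f (q ℕ.+ 1)
    single-root = ≡.subst (HasSingleRoot f) (ℕ.+-comm 1 q) (r , root , unique , divides-P , P-max)
      where
      root : IsRoot f r
      root = begin
        eval f r               ≈⟨ eval-f≈eval-P r ⟩
        eval P r               ≈⟨ eval-P r ⟩
        (r - r) * φ (r - r)    ≈⟨ *-congʳ (-‿inverseʳ r) ⟩
        0# * φ (r - r)         ≈⟨ zeroˡ _ ⟩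
        0#                     ∎
      unique : ∀ s → IsRoot f s → s ≈ r
      unique s s-root = x∙y⁻¹≈ε⇒x≈y s r (decidable-stable (s - r ≟ 0#) λ s-r≉0 →
        ^-≉0 (suc q) s-r≉0 (trans (sym (trans (eval-f≈eval-P s) (eval-P s))) s-root))
      divides-P : P ∣ₚ f
      divides-P = C 1# , coeffwise λ i →
        trans (coeff-C*ₚ 1# P i) (trans (*-identityˡ _) (sym (_≈ₚ_.coeff-≈ f≈P i)))
      -- The divisor is monic of degree q + 2 while `f` has degree q + 1, so the cofactor `g` is
      -- zero, and with it `f`, against its leading coefficient.
      P-max : (X- r) ^ₚ suc (suc q) ∤ₚ f
      P-max (g , coeffwise gP′≈f) = 1≉0 (begin
        1#                              ≈⟨ Monic.lead f-monic ⟨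
        coeff f (suc q)                 ≈⟨ gP′≈f (suc q) ⟨
        coeff (g *ₚ P′) (suc q)         ≈⟨ vanishing-*ₚ g P′ g-vanishes (suc q) z≤n ⟩
        0#                              ∎)
        where
        P′ = (X- r) ^ₚ suc (suc q)
        g-vanishes : DegreeBelow 0 g
        g-vanishes = multiple-of-monic-vanishes g P′ (monic-linear-^ₚ _ (suc (suc q)))
          λ i q<i → trans (gP′≈f i) (Monic.below f-monic i q<i)

  -- The case of `a` not fixed by `φ`: q + 1 distinct roots.

  module NotFixed (φa≉a : ¬ (φ a ≈ a)) where
    b₁≉b : ¬ (b₁ ≈ b)
    b₁≉b b₁≈b = φa≉a (inverse-fixed (trans (*-comm b a) ab≈1) b₁≈b)

    -- Another application of `φ` to such an equation returns to `b` by `φ³`.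
    b₂≉b₁ : ¬ (b₂ ≈ b₁)
    b₂≉b₁ b₂≈b₁ = b₁≉b (trans (sym (trans (φ-cong b₂≈b₁) b₂≈b₁)) (φ³ b))

    b-b₁≉0 : ¬ (b - b₁ ≈ 0#)
    b-b₁≉0 eq = b₁≉b (sym (x∙y⁻¹≈ε⇒x≈y b b₁ eq))

    -- A vanishing denominator would make `b₁` the negative of an element of `F`, hence fixed by
    -- `φ`.
    base+b₁≉0 : ∀ i → ¬ (base i + b₁ ≈ 0#)
    base+b₁≉0 i eq = b₂≉b₁ (begin
      b₂              ≈⟨ φ-cong b₁≈-x ⟩
      φ (- base i)    ≈⟨ φ-neg (base i) ⟩
      - φ (base i)    ≈⟨ -‿cong (φ-⟦⟧ _) ⟩
      - base i        ≈⟨ b₁≈-x ⟨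
      b₁              ∎)
      where
      b₁≈-x : b₁ ≈ - base i
      b₁≈-x = inverseˡ-unique b₁ (base i) (trans (+-comm _ _) eq)

    u : Fin q → Carrier
    u i = proj₁ (inverse (base+b₁≉0 i))

    u-inverse : ∀ i → (base i + b₁) * u i ≈ 1#
    u-inverse i = proj₂ (inverse (base+b₁≉0 i))

    -- With Y = X + b and d = b - b₁ the equation is Y^(q+1) + d Y + d φ²(d) = 0; it is
    -- satisfied by Y = d φ(w)/w for w in the F-span of 1 and b₁.
    s : Vector Carrier (suc q)
    s Fin.zero    = - b₁
    s (Fin.suc i) = (b - b₁) * (base i + b₂) * u i - b

    s-root : ∀ i → IsRoot f (s i)
    s-root Fin.zero = begin
      eval f (- b₁)
        ≈⟨ eval-f (- b₁) ⟩
      - b₁ * φ (- b₁) + b * (φ (- b₁) + - b₁) + (b * b₂ + b * b₁ - b₁ * b₂)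
        ≈⟨ +-congʳ (+-cong (*-congˡ (φ-neg b₁)) (*-congˡ (+-congʳ (φ-neg b₁)))) ⟩
      - b₁ * - b₂ + b * (- b₂ + - b₁) + (b * b₂ + b * b₁ - b₁ * b₂)
        ≈⟨ solve 3 (λ b b₁ b₂ → :- b₁ :* :- b₂ :+ b :* (:- b₂ :+ :- b₁) :+ (b :* b₂ :+ b :* b₁ :- b₁ :* b₂)
                                := con (+ 0)) refl b b₁ b₂ ⟩
      0# ∎
    s-root (Fin.suc i) = begin
      eval f y
        ≈⟨ eval-f y ⟩
      y * φ y + b * (φ y + y) + (b * b₂ + b * b₁ - b₁ * b₂)
        ≈⟨ +-congʳ (+-cong (*-congˡ φy≈) (*-congˡ (+-congʳ φy≈))) ⟩
      y * y₁ + b * (y₁ + y) + (b * b₂ + b * b₁ - b₁ * b₂)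
        -- The inverses `v` and `v₁` are free variables here, so the value is written as a
        -- combination of the defects of their two defining relations. Removing `v₁` by the first
        -- leaves the linear relation `φ(d) φ²(w) + d φ(w) = - φ²(d) w` at `w = x + b₁`, which
        -- produces the coefficient `- d φ²(d) = (b - b₁) * (b - b₂)` of the second.
        ≈⟨ solve 6 (λ x b b₁ b₂ v v₁ →
             let y  = (b :- b₁) :* (x :+ b₂) :* v :- b
                 y₁ = (b₁ :- b₂) :* (x :+ b) :* v₁ :- b₁
             in y :* y₁ :+ b :* (y₁ :+ y) :+ (b :* b₂ :+ b :* b₁ :- b₁ :* b₂)
             := (b :- b₁) :* (b₁ :- b₂) :* (x :+ b) :* v :* ((x :+ b₂) :* v₁ :- con (+ 1))
                :+ (b :- b₁) :* (b :- b₂) :* ((x :+ b₁) :* v :- con (+ 1)))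
           refl x b b₁ b₂ v v₁ ⟩
      (b - b₁) * (b₁ - b₂) * (x + b) * v * ((x + b₂) * v₁ - 1#)
        + (b - b₁) * (b - b₂) * ((x + b₁) * v - 1#)
        ≈⟨ +-cong (*-congˡ (x≈y⇒x∙y⁻¹≈ε v₁-inverse)) (*-congˡ (x≈y⇒x∙y⁻¹≈ε (u-inverse i))) ⟩
      (b - b₁) * (b₁ - b₂) * (x + b) * v * 0# + (b - b₁) * (b - b₂) * 0#
        ≈⟨ +-cong (zeroʳ _) (zeroʳ _) ⟩
      0# + 0#
        ≈⟨ +-identityˡ 0# ⟩
      0# ∎
      where
      x v v₁ y y₁ : Carrier
      x  = base i
      v  = u i
      v₁ = φ v
      y  = s (Fin.suc i)
      y₁ = (b₁ - b₂) * (x + b) * v₁ - b₁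
      φ-x+ : ∀ z → φ (x + z) ≈ x + φ z
      φ-x+ z = trans (φ-+ x z) (+-congʳ (φ-⟦⟧ _))
      v₁-inverse : (x + b₂) * v₁ ≈ 1#
      v₁-inverse = trans (*-congʳ (sym (φ-x+ b₁))) (φ-inverse (u-inverse i))
      φ-minus : ∀ z w → φ (z - w) ≈ φ z - φ w
      φ-minus z w = trans (φ-+ z (- w)) (+-congˡ (φ-neg w))
      φy≈ : φ y ≈ y₁
      φy≈ = begin
        φ ((b - b₁) * (x + b₂) * v - b)          ≈⟨ φ-minus _ b ⟩
        φ ((b - b₁) * (x + b₂) * v) - b₁         ≈⟨ +-congʳ (trans (φ-* _ v) (*-congʳ (φ-* _ _))) ⟩
        φ (b - b₁) * φ (x + b₂) * v₁ - b₁        ≈⟨ +-congʳ (*-congʳ (*-cong (φ-minus b b₁)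
                                                      (trans (φ-x+ b₂) (+-congˡ (φ³ b))))) ⟩
        (b₁ - b₂) * (x + b) * v₁ - b₁            ∎

    -- This is `φ(w) / w` at `w = base i + b₁`, a Möbius transformation of `base i` with determinant
    -- `b₁ - b₂`. Its value 1 at infinity corresponds to `s zero`.
    ratio : Fin q → Carrier
    ratio i = (base i + b₂) * u i

    ratio-* : ∀ i → (base i + b₁) * ratio i ≈ base i + b₂
    ratio-* i = begin
      (base i + b₁) * ((base i + b₂) * u i)   ≈⟨ solve 3 (λ y z v → y :* (z :* v) := z :* (y :* v)) refl _ _ _ ⟩
      (base i + b₂) * ((base i + b₁) * u i)   ≈⟨ *-congˡ (u-inverse i) ⟩
      (base i + b₂) * 1#                      ≈⟨ *-identityʳ _ ⟩
      base i + b₂                             ∎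

    s+b : ∀ i → s (Fin.suc i) + b ≈ (b - b₁) * ratio i
    s+b i = solve 4 (λ d z v b → d :* z :* v :- b :+ b := d :* (z :* v)) refl (b - b₁) (base i + b₂) (u i) b

    s-zero≉s-suc : ∀ i → ¬ (s Fin.zero ≈ s (Fin.suc i))
    s-zero≉s-suc i eq = b₂≉b₁ (∙-cancelˡ (base i) b₂ b₁ (begin
      base i + b₂               ≈⟨ ratio-* i ⟨
      (base i + b₁) * ratio i   ≈⟨ *-congˡ ratio≈1 ⟩
      (base i + b₁) * 1#        ≈⟨ *-identityʳ _ ⟩
      base i + b₁               ∎))
      where
      ratio≈1 : ratio i ≈ 1#
      ratio≈1 = *-cancelˡ-≉0 b-b₁≉0 (begin
        (b - b₁) * ratio i   ≈⟨ s+b i ⟨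
        s (Fin.suc i) + b    ≈⟨ +-congʳ eq ⟨
        - b₁ + b             ≈⟨ +-comm _ _ ⟩
        b - b₁               ≈⟨ *-identityʳ _ ⟨
        (b - b₁) * 1#        ∎)

    -- Cross multiplication of two equal ratios leaves the nonzero determinant, up to sign, times
    -- the difference of the arguments.
    s-suc-injective : ∀ i j → s (Fin.suc i) ≈ s (Fin.suc j) → base i ≈ base j
    s-suc-injective i j eq = x∙y⁻¹≈ε⇒x≈y x y (integral b₂-b₁≉0 (begin
      (b₂ - b₁) * (x - y)
        ≈⟨ solve 4 (λ x y b₁ b₂ → (b₂ :- b₁) :* (x :- y)
                                  := (x :+ b₁) :* (y :+ b₂) :- (y :+ b₁) :* (x :+ b₂)) refl x y b₁ b₂ ⟩
      (x + b₁) * (y + b₂) - (y + b₁) * (x + b₂)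
        ≈⟨ +-cong (*-congˡ (ratio-* j)) (-‿cong (*-congˡ (ratio-* i))) ⟨
      (x + b₁) * ((y + b₁) * ratio j) - (y + b₁) * ((x + b₁) * ratio i)
        ≈⟨ +-congˡ (-‿cong (*-congˡ (*-congˡ ratio≈))) ⟩
      (x + b₁) * ((y + b₁) * ratio j) - (y + b₁) * ((x + b₁) * ratio j)
        ≈⟨ solve 3 (λ x y z → x :* (y :* z) :- y :* (x :* z) := con (+ 0)) refl (x + b₁) (y + b₁) (ratio j) ⟩
      0# ∎))
      where
      x = base i
      y = base j
      b₂-b₁≉0 : ¬ (b₂ - b₁ ≈ 0#)
      b₂-b₁≉0 eq = b₂≉b₁ (x∙y⁻¹≈ε⇒x≈y b₂ b₁ eq)
      ratio≈ : ratio i ≈ ratio j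
      ratio≈ = *-cancelˡ-≉0 b-b₁≉0 (trans (sym (s+b i)) (trans (+-congʳ eq) (s+b j)))

    s-injective : Injective _≡_ _≈_ s
    s-injective {Fin.zero}  {Fin.zero}  _  = ≡.refl
    s-injective {Fin.zero}  {Fin.suc j} eq = contradiction eq (s-zero≉s-suc j)
    s-injective {Fin.suc i} {Fin.zero}  eq = contradiction (sym eq) (s-zero≉s-suc i)
    s-injective {Fin.suc i} {Fin.suc j} eq = ≡.cong Fin.suc (base-injective (s-suc-injective i j eq))

    roots-distinct : RootsDistinct f
    roots-distinct = simple-roots⇒RootsDistinct f-monic s s-injective s-root

    splits : Splits f
    splits = suc q , s , simple-roots-factorisation f-monic s s-injective s-root

  conclusion : SplitsIn⋆ f × (a ∈Image → HasSingleRoot f (q ℕ.+ 1)) × (¬ (a ∈Image) → RootsDistinct f)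
  conclusion = (splits , λ x root → ≉0⇒# (f-root⇒≉0 x root))
    , (λ a∈F → Fixed.single-root (image⇒fixed a∈F))
    , (λ a∉F → NotFixed.roots-distinct (a∉F ∘ fixed⇒image))
    where
    splits : Splits f
    splits with φ a ≟ a
    ... | yes φa≈a = Fixed.splits φa≈a
    ... | no φa≉a  = NotFixed.splits φa≉a

open import Data.Nat.Base using (_+_; _^_)

theorem1p4 :
  ∀ {c ℓ₁ ℓ₂ d m₁ m₂} (q : ℕ) → IsOddPrimePower q →
  (F : FiniteField c ℓ₁ ℓ₂ q) (K : FiniteField d m₁ m₂ (q ^ 3)) (ι : Embedding F K) →
  let open FiniteField K using (Carrier)
      open FiniteField K using (_#_)
      open FiniteField K using (0#)
      open Embedding ι using (_∈Image)
      open FieldPolynomial K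
      open Fₐ q K using (fₐ)
  in
  (a : Carrier) (a#0 : a # 0#) →
    SplitsIn⋆ (fₐ a a#0)
    × (a ∈Image → HasSingleRoot (fₐ a a#0) (q + 1))
    × (¬ (a ∈Image) → RootsDistinct (fₐ a a#0))
theorem1p4 q q-power F K ι a a#0 = RootsOfFₐ.conclusion q q-power F K ι a a#0
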